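{- Let $n\in\mathbb{N}$ and $T\in\mathbb{Z}$. (i) $T\in\mathscr{S}_2(n)$ if and only if $2n-T^2$ is the square of an integer. (ii) $T\in\mathscr{S}_3(n)$ if and only if either - $T=\pm 3t$ and $n=3t^2$ for some $t\in\mathbb{N}$, or - $3n-T^2>0$ and the following holds. Write $3n-T^2=D_0D_1^2$ with $D_0,D_1\in\mathbb{N}$ and $D_0$ squarefree, say $D_0=2^k3^\ell q_1\cdots q_r$ with $k,\ell\in\{0,1\}$ and $q_1,\ldots,q_r$ ($r\ge 0$) pairwise different primes with $q_i\notin\{2,3\}$. Then (a) $q_i\equiv 1 \pmod 6$ for all $1\le i\le r$, and (b) if $\ell=1$ or $\gcd(3,T,n)=3$, then $k=1$. (iv) For $5\le m\le 7$: $T\in\mathscr{S}_m(n)$ if and only if $n\equiv T\pmod 2$ and $mn-T^2\ge 0$. In particular, $\mathscr{S}_m(n)$ is full for $5\le m\le 7$.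
   Context: $\mathbb{N}$ denotes the positive integers. For $m,n\in\mathbb{N}$, $\mathscr{S}_m(n)$ is the set of all $T\in\mathbb{Z}$ for which there exist $x_1,\ldots,x_m\in\mathbb{Z}$ with $x_1+\cdots+x_m=T$ and $x_1^2+\cdots+x_m^2=n$. Let $\mathscr{T}_m(n)=\{T\in\mathbb{Z}: n\equiv T \pmod 2,\ T^2<mn\}$ and $\mathscr{S}_m'(n)=\{T\in\mathscr{S}_m(n): T^2<mn\}$. $\mathscr{S}_m(n)$ is called full if $\mathscr{S}_m'(n)=\mathscr{T}_m(n)$. -}

module Defs where

open import Data.Nat as ℕ using (ℕ; zero; suc)
open import Data.Nat.Divisibility as ℕD using ()
open import Data.Nat.Primality using (Prime)
open import Data.Integer as ℤ using (ℤ; +_; _+_; _*_; _-_; _<_)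
open import Data.Integer.Divisibility as ℤD using ()
open import Data.Vec using (Vec; []; _∷_)
open import Data.Product using (Σ; ∃; _×_)
open import Relation.Binary.PropositionalEquality using (_≡_)
open import Relation.Nullary using (¬_)
open import Function.Bundles using (_⇔_)

sumℤ : ∀ {m} → Vec ℤ m → ℤ
sumℤ []       = + 0
sumℤ (x ∷ xs) = x + sumℤ xs

sumSqℤ : ∀ {m} → Vec ℤ m → ℤ
sumSqℤ []       = + 0
sumSqℤ (x ∷ xs) = x * x + sumSqℤ xs

𝒮 : (m n : ℕ) → ℤ → Set
𝒮 m n T = Σ (Vec ℤ m) λ x → sumℤ x ≡ T × sumSqℤ x ≡ + n

SameParity : ℕ → ℤ → Set
SameParity n T = (+ 2) ℤD.∣ ((+ n) - T)

𝒯 : (m n : ℕ) → ℤ → Set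
𝒯 m n T = SameParity n T × T * T < + (m ℕ.* n)

𝒮′ : (m n : ℕ) → ℤ → Set
𝒮′ m n T = 𝒮 m n T × T * T < + (m ℕ.* n)

Full : (m n : ℕ) → Set
Full m n = ∀ T → 𝒮′ m n T ⇔ 𝒯 m n T

SquareFree : ℕ → Set
SquareFree d = ∀ p → Prime p → ¬ ((p ℕ.* p) ℕD.∣ d)

{-# OPTIONS --safe #-}

-- (i) 2n - T² = (x - y)².
--
-- (ii) 3n - T² = 2 (a² + ab + b²) for a = x - y and b = y - z, and conversely x, y, z can be
-- recovered from T and ±(a, b) because T ≡ ±(a - b) modulo 3.  Values of the norm form are
-- closed under products, contain 3 and all primes p ≡ 1 mod 3 (x ↦ 1 / (1 - x) has order three on
-- the p - 2 residues other than 0 and 1, so it has a fixed point; hence p divides some x² + x + 1,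
-- and forms of discriminant -3 reduce to the norm form), and have even exponents at the primes
-- q ≡ 2 mod 3, since such a q divides no x² + x + 1.
--
-- (iv) The case m + 1 follows from m by splitting off the integer nearest to T / (m + 1), for m = 5, 6.
-- For m = 5, splitting off a suitable s leaves four numbers with odd sum, which exist because
-- every number ≡ 3 mod 8 is a sum of three odd squares.
--
-- The latter is proved by counting.  For odd M let t (M) and g (M) be the numbers of solutions in odd
-- positive numbers of x² + y² + z² = 4M - 1 and of xy + yz + zx = 4M - 1.  Clearly g (M) > 0.  The sum of
-- κ² - M over the solutions of κ² + x² + y² + z² = 4M is zero by symmetry, which determines t
-- recursively.  The sum over the solutions of κ² + RS + ST + TR = 4M is zero as well: it
-- suffices that the sums of κ² and of RS agree, and this follows from cutting cones in the
-- space of solutions along hyperplanes and matching the pieces linearly.  Hence t = g.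
module Submission where

open import Defs

-- Four integers with odd sum t and square sum ν exist once 4ν - t² is a sum of three odd squares,
-- and if ν and t are odd, then 4ν - t² ≡ 3 mod 8 is automatic. Hence the part split off for m = 5
-- is chosen to leave an odd sum.
--
-- Three odd squares are compared with xy + yz + zx because there a solution is visible, namely (1,
-- 1, 2M - 1); the comparison uses finite sums only, neither ternary form reduction nor primes in
-- progressions. The recursion works because κ is odd: κ² = 8t + 1 turns the solutions with fixed κ
-- > 1 into those for a smaller M, while κ = 1 carries the coefficient 1 - M, nonzero for M > 1. For
-- M = 1 both equations have the single solution (1, 1, 1).
--
-- In (ii), 3n - T² has to be twice a norm, and 2 is inert, so D₀ has to be even. If 3 does not
-- divide T, then 3n - T² ≡ 2 mod 3 is not a norm, and with (a) this already forces 2 into D₀. If 3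
-- divides T, then either 3 divides D₀ or 3 divides both D₁ and n; these are the two cases in which
-- (b) demands k = 1.

-- Finite sums and the cutting of a square of indices along its diagonal.

module Summation where

  open import Data.Bool.Base using (true; false; T; if_then_else_)
  open import Data.Empty using (⊥-elim)
  open import Data.Nat.Base
  open import Data.Nat.Properties
  open import Data.Nat.Tactic.RingSolver using (solve-∀)
  open import Data.Product using (∃; _,_)
  open import Function.Base using (_∘_)
  open import Relation.Binary.PropositionalEquality
  open import Relation.Nullary using (¬_; yes; no)

  ∑ : ℕ → (ℕ → ℕ) → ℕ
  ∑ zero    f = 0
  ∑ (suc K) f = f 0 + ∑ K (f ∘ suc)

  ∑-cong : ∀ K {f g : ℕ → ℕ} → (∀ i → f i ≡ g i) → ∑ K f ≡ ∑ K g
  ∑-cong zero    f≗g = refl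
  ∑-cong (suc K) f≗g = cong₂ _+_ (f≗g 0) (∑-cong K (f≗g ∘ suc))

  ∑-+ : ∀ K (f g : ℕ → ℕ) → ∑ K (λ i → f i + g i) ≡ ∑ K f + ∑ K g
  ∑-+ zero    f g = refl
  ∑-+ (suc K) f g = trans (cong (f 0 + g 0 +_) (∑-+ K (f ∘ suc) (g ∘ suc)))
                          (interchange (f 0) (g 0) (∑ K (f ∘ suc)) (∑ K (g ∘ suc)))
    where
    interchange : ∀ a b c d → a + b + (c + d) ≡ a + c + (b + d)
    interchange = solve-∀

  ∑-zero : ∀ K {f : ℕ → ℕ} → (∀ i → i < K → f i ≡ 0) → ∑ K f ≡ 0
  ∑-zero zero    z = refl
  ∑-zero (suc K) z = cong₂ _+_ (z 0 z<s) (∑-zero K (λ i i<K → z (suc i) (s<s i<K)))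

  ∑-swap : ∀ K L (h : ℕ → ℕ → ℕ) → ∑ K (λ i → ∑ L (h i)) ≡ ∑ L (λ j → ∑ K (λ i → h i j))
  ∑-swap zero    L h = sym (∑-zero L (λ _ _ → refl))
  ∑-swap (suc K) L h = trans (cong (∑ L (h 0) +_) (∑-swap K L (h ∘ suc))) (sym (∑-+ L (h 0) _))

  ∑-*ˡ : ∀ K c (f : ℕ → ℕ) → ∑ K (λ i → c * f i) ≡ c * ∑ K f
  ∑-*ˡ zero    c f = sym (*-zeroʳ c)
  ∑-*ˡ (suc K) c f = trans (cong (c * f 0 +_) (∑-*ˡ K c (f ∘ suc))) (sym (*-distribˡ-+ c (f 0) _))

  ∑-++ : ∀ b K (f : ℕ → ℕ) → ∑ (b + K) f ≡ ∑ b f + ∑ K (λ a → f (b + a))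
  ∑-++ zero    K f = refl
  ∑-++ (suc b) K f = trans (cong (f 0 +_) (∑-++ b K (f ∘ suc))) (sym (+-assoc (f 0) _ _))

  -- Terms beyond the cutoff vanish, so the range can be lengthened by b before its first b terms
  -- are split off. The tail again has K terms, which lets all sums share one cutoff.
  ∑-shift : ∀ K b {f : ℕ → ℕ} → (∀ i → K ≤ i → f i ≡ 0) → ∑ K f ≡ ∑ b f + ∑ K (λ a → f (b + a))
  ∑-shift K b {f} v = begin
    ∑ K f                                ≡⟨ +-identityʳ _ ⟨
    ∑ K f + 0                            ≡⟨ cong (∑ K f +_) (∑-zero b (λ i _ → v (K + i) (m≤m+n K i))) ⟨
    ∑ K f + ∑ b (λ a → f (K + a))        ≡⟨ ∑-++ K b f ⟨
    ∑ (K + b) f                          ≡⟨ cong (λ c → ∑ c f) (+-comm K b) ⟩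
    ∑ (b + K) f                          ≡⟨ ∑-++ b K f ⟩
    ∑ b f + ∑ K (λ a → f (b + a))        ∎
    where open ≡-Reasoning

  ∑-term≤ : ∀ K (f : ℕ → ℕ) i → i < K → f i ≤ ∑ K f
  ∑-term≤ (suc K) f zero    _         = m≤m+n _ _
  ∑-term≤ (suc K) f (suc i) (s<s i<K) = ≤-trans (∑-term≤ K (f ∘ suc) i i<K) (m≤n+m _ (f 0))

  ∑≢0⇒∃ : ∀ K (f : ℕ → ℕ) → ∑ K f ≢ 0 → ∃ λ i → f i ≢ 0
  ∑≢0⇒∃ zero    f nz = ⊥-elim (nz refl)
  ∑≢0⇒∃ (suc K) f nz with f 0 ≟ 0
  ... | no  f0≢0 = 0 , f0≢0
  ... | yes f0≡0 with ∑≢0⇒∃ K (f ∘ suc) (λ e → nz (cong₂ _+_ f0≡0 e))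
  ...   | i , p = suc i , p

  if-true : ∀ {a b} → a < b → (x y : ℕ) → (if a <ᵇ b then x else y) ≡ x
  if-true {a} {b} a<b x y with a <ᵇ b in eq
  ... | true  = refl
  ... | false = ⊥-elim (subst T eq (<⇒<ᵇ a<b))

  if-false : ∀ {a b} → ¬ a < b → (x y : ℕ) → (if a <ᵇ b then x else y) ≡ y
  if-false {a} {b} a≮b x y with a <ᵇ b in eq
  ... | true  = ⊥-elim (a≮b (<ᵇ⇒< a b (subst T (sym eq) _)))
  ... | false = refl

  -- Taking the difference as a new variable, i = j + a or j = i + 1 + a, is the only change of
  -- variables in the counting argument besides permutations.
  ∑∑-split : ∀ K (h : ℕ → ℕ → ℕ) → (∀ i j → K ≤ i → h i j ≡ 0) → (∀ i j → K ≤ j → h i j ≡ 0) →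
    ∑ K (λ i → ∑ K (h i)) ≡
    ∑ K (λ a → ∑ K (λ j → h (j + a) j)) + ∑ K (λ i → ∑ K (λ a → h i (suc (i + a))))
  ∑∑-split K h vi vj = begin
    ∑ K (λ i → ∑ K (h i))
      ≡⟨ ∑-cong K (λ i → ∑-cong K (λ j → lo+up i j)) ⟩
    ∑ K (λ i → ∑ K (λ j → lo i j + up i j))
      ≡⟨ ∑-cong K (λ i → ∑-+ K (lo i) (up i)) ⟩
    ∑ K (λ i → ∑ K (lo i) + ∑ K (up i))
      ≡⟨ ∑-+ K _ _ ⟩
    ∑ K (λ i → ∑ K (lo i)) + ∑ K (λ i → ∑ K (up i))
      ≡⟨ cong₂ _+_ (trans (∑-swap K K lo) (trans (∑-cong K lower) (∑-swap K K _))) (∑-cong K upper) ⟩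
    ∑ K (λ a → ∑ K (λ j → h (j + a) j)) + ∑ K (λ i → ∑ K (λ a → h i (suc (i + a))))
      ∎
    where
    open ≡-Reasoning
    lo up : ℕ → ℕ → ℕ
    lo i j = if i <ᵇ j then 0 else h i j
    up i j = if i <ᵇ j then h i j else 0
    lo+up : ∀ i j → h i j ≡ lo i j + up i j
    lo+up i j with i <ᵇ j
    ... | true  = refl
    ... | false = sym (+-identityʳ _)
    lo-v : ∀ i j → K ≤ i → lo i j ≡ 0
    lo-v i j K≤i with i <ᵇ j
    ... | true  = refl
    ... | false = vi i j K≤i
    up-v : ∀ i j → K ≤ j → up i j ≡ 0
    up-v i j K≤j with i <ᵇ j
    ... | true  = vj i j K≤j
    ... | false = refl
    lower : ∀ j → ∑ K (λ i → lo i j) ≡ ∑ K (λ a → h (j + a) j)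
    lower j = trans (∑-shift K j (λ i → lo-v i j))
      (cong₂ _+_ (∑-zero j (λ i i<j → if-true i<j 0 _))
                 (∑-cong K (λ a → if-false (≤⇒≯ (m≤m+n j a)) 0 _)))
    upper : ∀ i → ∑ K (up i) ≡ ∑ K (λ a → h i (suc (i + a)))
    upper i = trans (∑-shift K (suc i) (up-v i))
      (cong₂ _+_ (∑-zero (suc i) (λ j j≤i → if-false (≤⇒≯ (s≤s⁻¹ j≤i)) (h i j) 0))
                 (∑-cong K (λ a → if-true (s≤s (m≤m+n i a)) _ 0)))

  ∑∑-split₃ : ∀ K (h : ℕ → ℕ → ℕ) → (∀ i j → K ≤ i → h i j ≡ 0) → (∀ i j → K ≤ j → h i j ≡ 0) →
    ∑ K (λ i → ∑ K (h i)) ≡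
    ∑ K (λ j → h j j) + ∑ K (λ a → ∑ K (λ j → h (j + suc a) j))
      + ∑ K (λ i → ∑ K (λ a → h i (suc (i + a))))
  ∑∑-split₃ K h vi vj = trans (∑∑-split K h vi vj) (cong₂ _+_ (trans
    (∑-shift K 1 (λ a K≤a → ∑-zero K (λ j _ → vi (j + a) j (≤-trans K≤a (m≤n+m a j)))))
    (cong₂ _+_ (trans (+-identityʳ _) (∑-cong K (λ j → cong (λ i → h i j) (+-identityʳ j)))) refl)) refl)

-- Weighted counts of solutions with prescribed parities, and their division into cones.

module Counting where

  open Summation
  open import Data.Bool.Base using (true; false; T; if_then_else_)
  open import Data.Empty using (⊥-elim)
  open import Data.Nat.Base
  open import Data.Nat.Properties
  open import Data.Nat.Tactic.RingSolver using (solve-∀)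
  open import Relation.Binary.PropositionalEquality
  open import Relation.Nullary using (yes; no)

  opaque
    χ : ℕ → ℕ → ℕ → ℕ
    χ N m w = if m ≡ᵇ N then w else 0

    χ-≢ : ∀ N {m} w → m ≢ N → χ N m w ≡ 0
    χ-≢ N {m} w m≢N with m ≡ᵇ N in eq
    ... | true  = ⊥-elim (m≢N (≡ᵇ⇒≡ m N (subst T (sym eq) _)))
    ... | false = refl

    χ-≡ : ∀ N w → χ N N w ≡ w
    χ-≡ N w with N ≡ᵇ N in eq
    ... | true  = refl
    ... | false = ⊥-elim (subst T eq (≡⇒≡ᵇ N N refl))

    χ-+ : ∀ N m v w → χ N m (v + w) ≡ χ N m v + χ N m w
    χ-+ N m v w with m ≡ᵇ N
    ... | true  = refl
    ... | false = refl

    χ-*ˡ : ∀ N m c w → χ N m (c * w) ≡ c * χ N m w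
    χ-*ˡ N m c w with m ≡ᵇ N
    ... | true  = refl
    ... | false = sym (*-zeroʳ c)

    χ-self : ∀ N m → χ N m m ≡ χ N m N
    χ-self N m with m ≟ N
    ... | yes refl = refl
    ... | no  m≢N  = trans (χ-≢ N m m≢N) (sym (χ-≢ N N m≢N))

    χ-+ˡ : ∀ a N m w → χ (a + N) (a + m) w ≡ χ N m w
    χ-+ˡ zero    N m w = refl
    χ-+ˡ (suc a) N m w = χ-+ˡ a N m w

  χ-≢0 : ∀ N {m w} → χ N m w ≢ 0 → m ≡ N
  χ-≢0 N {m} {w} nz with m ≟ N
  ... | yes m≡N = m≡N
  ... | no  m≢N = ⊥-elim (nz (χ-≢ N w m≢N))

  data Parity : Set where
    odd even : Parity

  pred# : Parity → ℕ → ℕ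
  pred# odd  i = i + i
  pred# even i = suc (i + i)

  -- The positive numbers of one parity: `odd # i` is 2i + 1 and `even # i` is 2i + 2. The successor
  -- stands outermost so that positivity is visible to the dominance conditions.
  _#_ : Parity → ℕ → ℕ
  p # i = suc (pred# p i)

  i≤pred# : ∀ p i → i ≤ pred# p i
  i≤pred# odd  i = m≤m+n i i
  i≤pred# even i = ≤-trans (m≤m+n i i) (n≤1+n _)

  Fun₄ : Set
  Fun₄ = ℕ → ℕ → ℕ → ℕ → ℕ

  -- A coordinate bounded by the value of F stays below the cutoff on solutions of F = N, so the
  -- terms beyond the cutoff vanish, as `∑∑-split` requires.
  Dominates₀ Dominates₁ : Fun₄ → Set
  Dominates₀ F = ∀ x y z t → suc x ≤ F (suc x) (suc y) (suc z) (suc t)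
  Dominates₁ F = ∀ x y z t → suc y ≤ F (suc x) (suc y) (suc z) (suc t)

  module Weighted (K N : ℕ) where

    opaque

      -- The sum of w over the solutions of F = N in positive numbers of the given parities.
      -- The cutoff K only has to exceed N.
      S : (p q r s : Parity) (F w : Fun₄) → ℕ
      S p q r s F w = ∑ K λ i → ∑ K λ j → ∑ K λ k → ∑ K λ l →
        χ N (F (p # i) (q # j) (r # k) (s # l)) (w (p # i) (q # j) (r # k) (s # l))

      S-cong : ∀ p q r s {F F′ w w′ : Fun₄} →
        (∀ x y z t → F x y z t ≡ F′ x y z t) → (∀ x y z t → w x y z t ≡ w′ x y z t) →
        S p q r s F w ≡ S p q r s F′ w′
      S-cong p q r s F≗ w≗ = ∑-cong K λ i → ∑-cong K λ j → ∑-cong K λ k → ∑-cong K λ l →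
        cong₂ (χ N) (F≗ (p # i) (q # j) (r # k) (s # l)) (w≗ (p # i) (q # j) (r # k) (s # l))

      S-+ : ∀ p q r s (F v w : Fun₄) →
        S p q r s F (λ x y z t → v x y z t + w x y z t) ≡ S p q r s F v + S p q r s F w
      S-+ p q r s F v w =
        trans (∑-cong K λ i → trans (∑-cong K λ j → trans (∑-cong K λ k → trans (∑-cong K λ l →
          χ-+ N (F (p # i) (q # j) (r # k) (s # l)) _ _) (∑-+ K _ _)) (∑-+ K _ _)) (∑-+ K _ _)) (∑-+ K _ _)

      S-*ˡ : ∀ p q r s c (F w : Fun₄) → S p q r s F (λ x y z t → c * w x y z t) ≡ c * S p q r s F w
      S-*ˡ p q r s c F w =
        trans (∑-cong K λ i → trans (∑-cong K λ j → trans (∑-cong K λ k → trans (∑-cong K λ l →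
          χ-*ˡ N (F (p # i) (q # j) (r # k) (s # l)) c _) (∑-*ˡ K c _)) (∑-*ˡ K c _)) (∑-*ˡ K c _)) (∑-*ˡ K c _)

      -- On the support of `χ` the form has the value N. This links the sums of the individual terms
      -- of F to the number of solutions.
      S-self : ∀ p q r s (F : Fun₄) → S p q r s F F ≡ S p q r s F (λ _ _ _ _ → N)
      S-self p q r s F = ∑-cong K λ i → ∑-cong K λ j → ∑-cong K λ k → ∑-cong K λ l → χ-self N _

      S-01 : ∀ p q r s (F w : Fun₄) →
        S p q r s F w ≡ S q p r s (λ x y → F y x) (λ x y → w y x)
      S-01 p q r s F w = ∑-swap K K _

      S-12 : ∀ p q r s (F w : Fun₄) →
        S p q r s F w ≡ S p r q s (λ x y z → F x z y) (λ x y z → w x z y)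
      S-12 p q r s F w = ∑-cong K λ i → ∑-swap K K _

      S-23 : ∀ p q r s (F w : Fun₄) →
        S p q r s F w ≡ S p q s r (λ x y z t → F x y t z) (λ x y z t → w x y t z)
      S-23 p q r s F w = ∑-cong K λ i → ∑-cong K λ j → ∑-swap K K _

      S₃ : (p q r : Parity) (F w : ℕ → ℕ → ℕ → ℕ) → ℕ
      S₃ p q r F w = ∑ K λ i → ∑ K λ j → ∑ K λ k →
        χ N (F (p # i) (q # j) (r # k)) (w (p # i) (q # j) (r # k))

      S₃-empty : ∀ p q r (F w : ℕ → ℕ → ℕ → ℕ) → (∀ i j k → F (p # i) (q # j) (r # k) ≢ N) →
        S₃ p q r F w ≡ 0
      S₃-empty p q r F w ≢N = ∑-zero K λ i _ → ∑-zero K λ j _ → ∑-zero K λ k _ → χ-≢ N _ (≢N i j k)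

    fibre : (ℕ → ℕ → ℕ → ℕ) → ℕ → ℕ
    fibre G κ = ∑ K λ j → ∑ K λ k → ∑ K λ l → χ N (κ * κ + G (odd # j) (odd # k) (odd # l)) 1

    opaque
      unfolding S

      S-fibre : ∀ (G : ℕ → ℕ → ℕ → ℕ) (c : ℕ → ℕ) →
        S odd odd odd odd (λ κ x y z → κ * κ + G x y z) (λ κ _ _ _ → c κ) ≡
        ∑ K (λ i → c (odd # i) * fibre G (odd # i))
      S-fibre G c = ∑-cong K λ i → trans (∑-cong K λ j → trans (∑-cong K λ k → trans (∑-cong K λ l →
        trans (cong (χ N (F i j k l)) (sym (*-identityʳ (c (odd # i))))) (χ-*ˡ N (F i j k l) (c (odd # i)) 1))
        (∑-*ˡ K (c (odd # i)) _)) (∑-*ˡ K (c (odd # i)) _)) (∑-*ˡ K (c (odd # i)) _)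
        where
        F : Fun₄
        F i j k l = (odd # i) * (odd # i) + G (odd # j) (odd # k) (odd # l)

    module Split (N<K : N < K) (r s : Parity) (F w : Fun₄) (d₀ : Dominates₀ F) (d₁ : Dominates₁ F) where

      vanish : ∀ {m v} p i → p # i ≤ m → K ≤ i → χ N m v ≡ 0
      vanish p i #i≤m K≤i = χ-≢ N _ λ m≡N → <-irrefl (sym m≡N)
        (<-≤-trans N<K (≤-trans K≤i (≤-trans (i≤pred# p i) (≤-trans (n≤1+n _) #i≤m))))

      h : Parity → Parity → ℕ → ℕ → ℕ
      h p q i j = ∑ K λ k → ∑ K λ l →
        χ N (F (p # i) (q # j) (r # k) (s # l)) (w (p # i) (q # j) (r # k) (s # l))

      v₀ : ∀ p q i j → K ≤ i → h p q i j ≡ 0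
      v₀ p q i j K≤i = ∑-zero K λ k _ → ∑-zero K λ l _ → vanish p i (d₀ _ _ _ _) K≤i

      v₁ : ∀ p q i j → K ≤ j → h p q i j ≡ 0
      v₁ p q i j K≤j = ∑-zero K λ k _ → ∑-zero K λ l _ → vanish q j (d₁ _ _ _ _) K≤j

      slice : ∀ {x x′ y y′} → x ≡ x′ → y ≡ y′ →
        (∑ K λ k → ∑ K λ l → χ N (F x y (r # k) (s # l)) (w x y (r # k) (s # l))) ≡
        (∑ K λ k → ∑ K λ l → χ N (F x′ y′ (r # k) (s # l)) (w x′ y′ (r # k) (s # l)))
      slice refl refl = refl

      opaque
        unfolding S S₃

        -- Opposite parities exclude a diagonal, and the differences are odd. The cut is at i ≥ j
        -- because 2i + 2 > 2j + 1 exactly then.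
        split-even-odd : S even odd r s F w ≡ S odd odd r s (λ x y → F (y + x) y) (λ x y → w (y + x) y)
                                            + S even odd r s (λ x y → F x (x + y)) (λ x y → w x (x + y))
        split-even-odd = trans (∑∑-split K (h even odd) (v₀ even odd) (v₁ even odd)) (cong₂ _+_
          (∑-cong K λ a → ∑-cong K λ j → slice {x = even # (j + a)} (lem₁ j a) refl)
          (∑-cong K λ i → ∑-cong K λ a → slice {y = odd # (suc (i + a))} refl (lem₂ i a)))
          where
          lem₁ : ∀ j a → 2 + (j + a + (j + a)) ≡ 1 + (j + j) + (1 + (a + a))
          lem₁ = solve-∀
          lem₂ : ∀ i a → 1 + (1 + (i + a) + (1 + (i + a))) ≡ 2 + (i + i) + (1 + (a + a))
          lem₂ = solve-∀

        -- Equal parities leave a diagonal, the sum `S₃`, and even differences.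
        split-odd-odd : S odd odd r s F w ≡ S₃ odd r s (λ x → F x x) (λ x → w x x)
                                          + S even odd r s (λ x y → F (y + x) y) (λ x y → w (y + x) y)
                                          + S odd even r s (λ x y → F x (x + y)) (λ x y → w x (x + y))
        split-odd-odd = trans (∑∑-split₃ K (h odd odd) (v₀ odd odd) (v₁ odd odd)) (cong₂ _+_ (cong₂ _+_
          refl
          (∑-cong K λ a → ∑-cong K λ j → slice {x = odd # (j + suc a)} (lem₁ j a) refl))
          (∑-cong K λ i → ∑-cong K λ a → slice {y = odd # (suc (i + a))} refl (lem₂ i a)))
          where
          lem₁ : ∀ j a → 1 + (j + (1 + a) + (j + (1 + a))) ≡ 1 + (j + j) + (2 + (a + a))
          lem₁ = solve-∀
          lem₂ : ∀ i a → 1 + (1 + (i + a) + (1 + (i + a))) ≡ 1 + (i + i) + (2 + (a + a))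
          lem₂ = solve-∀

-- The second moment of κ on κ² + RS + ST + TR = N, by cutting and matching cones.

module ProductForm where

  open Counting
  open import Data.Nat.Base
  open import Data.Nat.Properties
  open import Data.Nat.Tactic.RingSolver using (solve-∀)
  open import Data.Product using (∃; _,_)
  open import Relation.Binary.PropositionalEquality

  in₁ : ∀ {x a} b c d → x ≤ a → x ≤ a + b + c + d
  in₁ {x} {a} b c d x≤a = ≤-trans x≤a (≤-trans (m≤m+n a b) (≤-trans (m≤m+n (a + b) c) (m≤m+n (a + b + c) d)))

  in₃ : ∀ {x c} a b d → x ≤ c → x ≤ a + b + c + d
  in₃ {x} {c} a b d x≤c = ≤-trans x≤c (≤-trans (m≤n+m c (a + b)) (m≤m+n (a + b + c) d))

  in₄ : ∀ {x d} a b c → x ≤ d → x ≤ a + b + c + d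
  in₄ {x} {d} a b c x≤d = ≤-trans x≤d (m≤n+m d (a + b + c))

  W : Fun₄
  W κ S R T = R * S + S * T + T * R + κ * κ

  -- Since `P (t + x) y z t` equals `W (t + y) t x z`, the sum `above` is the part x > t of a sum
  -- over solutions of P = N. This larger solution space can then be cut along other hyperplanes.
  P : Fun₄
  P x y z t = y * y + 2 * (y * t) + x * z + x * t

  8a≢4+8b : ∀ a b → 8 * a ≢ 4 + 8 * b
  8a≢4+8b zero    b       ()
  8a≢4+8b (suc a) zero    p with trans (sym (*-suc 8 a)) p
  ... | ()
  8a≢4+8b (suc a) (suc b) p = 8a≢4+8b a b (+-cancelˡ-≡ 8 _ _ (trans (sym (*-suc 8 a)) (trans p (lem b))))
    where
    lem : ∀ b → 4 + 8 * (1 + b) ≡ 8 + (4 + 8 * b)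
    lem = solve-∀

  half-pronic : ∀ p → ∃ λ t → p * suc p ≡ 2 * t
  half-pronic zero    = 0 , refl
  half-pronic (suc p) with half-pronic p
  ... | t , e = t + suc p , trans (lem₁ p) (trans (cong (_+ 2 * suc p) e) (lem₂ t (suc p)))
    where
    lem₁ : ∀ p → (1 + p) * (2 + p) ≡ p * (1 + p) + 2 * (1 + p)
    lem₁ = solve-∀
    lem₂ : ∀ t s → 2 * t + 2 * s ≡ 2 * (t + s)
    lem₂ = solve-∀

  module Ternary (K m : ℕ) (N<K : 4 + 8 * m < K) where

    open Weighted K (4 + 8 * m)

    -- The parts κ > S and κ < S of the sum of (R + κ) |κ - S|; their equality is shown by
    -- cutting both into pieces that also make up P₀, which is cut in two different ways.
    above below : ℕ
    above = S even odd odd odd (λ k S R T → W (S + k) S R T) (λ k S R T → (R + (S + k)) * k)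
    below = S odd even odd odd (λ κ s R T → W κ (κ + s) R T) (λ κ s R T → (R + κ) * s)

    Q₁ Q₂ Q₁₁ Q₁₂ : ℕ
    Q₁ = S odd odd odd odd (λ s R κ T → W κ (κ + (R + s)) R T) (λ s R κ T → (R + κ) * (R + s))
    Q₂ = S even odd odd odd (λ s R κ T → W κ (κ + s) (s + R) T) (λ s R κ T → (s + R + κ) * s)
    Q₁₁ = S even odd odd odd (λ v κ R T → W κ (κ + (R + (κ + v))) R T) (λ v κ R T → (R + κ) * (R + (κ + v)))
    Q₁₂ = S odd even odd odd (λ s w R T → W (s + w) (s + w + (R + s)) R T) (λ s w R T → (R + (s + w)) * (R + s))

    below-Q : below ≡ Q₁ + Q₂
    below-Q = trans (S-01 odd even odd odd _ _) (trans (S-12 even odd odd odd _ _)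
      (Split.split-even-odd N<K odd odd (λ s R κ T → W κ (κ + s) R T) (λ s R κ T → (R + κ) * s)
        (λ s R κ T → in₁ _ _ _ (≤-trans (m≤n+m _ (suc κ)) (m≤n*m (suc κ + suc s) (suc R))))
        (λ s R κ T → in₁ _ _ _ (m≤m*n (suc R) (suc κ + suc s)))))

    Q₁-Q : Q₁ ≡ Q₁₁ + Q₁₂
    Q₁-Q = trans (S-12 odd odd odd odd _ _)
      (trans (Split.split-odd-odd N<K odd odd (λ s κ R T → W κ (κ + (R + s)) R T) (λ s κ R T → (R + κ) * (R + s))
        (λ s κ R T → in₁ _ _ _ (≤-trans (m≤n+m _ (suc R)) (≤-trans (m≤n+m _ (suc κ)) (m≤n*m _ (suc R)))))
        (λ s κ R T → in₄ (suc R * (suc κ + (suc R + suc s))) _ _ (m≤m*n (suc κ) (suc κ))))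
      (cong (λ z → z + Q₁₁ + Q₁₂) (S₃-empty odd odd odd _ _ diagonal)))
      where
      factor : ∀ x R T →
        (1 + (R + R)) * (1 + (x + x) + (1 + (R + R) + (1 + (x + x))))
          + (1 + (x + x) + (1 + (R + R) + (1 + (x + x)))) * (1 + (T + T))
          + (1 + (T + T)) * (1 + (R + R)) + (1 + (x + x)) * (1 + (x + x))
        ≡ 4 * ((1 + (x + R)) * (2 + (x + R))) + 8 * ((1 + (x + R)) * T)
      factor = solve-∀
      lem : ∀ t u → 4 * (2 * t) + 8 * u ≡ 8 * (t + u)
      lem = solve-∀
      -- For s = κ = x the form is (R + x)(R + x + 2T) = 4u(u + T) with u = (R + x) / 2. As T is
      -- odd, u(u + T) is even, so the value is divisible by 8, whereas N ≡ 4 mod 8.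
      diagonal : ∀ x R T → W (odd # x) (odd # x + (odd # R + odd # x)) (odd # R) (odd # T) ≢ 4 + 8 * m
      diagonal x R T p with half-pronic (suc (x + R))
      ... | t , e = 8a≢4+8b (t + suc (x + R) * T) m (trans (sym (lem t (suc (x + R) * T)))
        (trans (cong (λ z → 4 * z + 8 * (suc (x + R) * T)) (sym e)) (trans (sym (factor x R T)) p)))

    P₀ Pᵇ P₁ P₂ P₂₁ P₂₂ P₂₂₁ : ℕ
    P₀ = S even even odd odd P (λ x y z t → y * (x + y))
    Pᵇ = S even odd even odd (λ x t y z → P x y z (x + t)) (λ x t y z → y * (x + y))
    P₁ = S odd odd even odd (λ y z x t → P x (z + y) z t) (λ y z x t → (z + y) * (x + (z + y)))
    P₂ = S even odd even odd (λ y z x t → P x y (y + z) t) (λ y z x t → y * (x + y))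
    P₂₁ = S odd odd even odd (λ x z y t → P (z + x) y (y + z) t) (λ x z y t → y * (z + x + y))
    P₂₂ = S even odd even odd (λ x z y t → P x y (y + (x + z)) t) (λ x z y t → y * (x + y))
    P₂₂₁ = S odd odd even odd (λ y z x t → P x (z + y) (z + y + (x + z)) t) (λ y z x t → (z + y) * (x + (z + y)))

    P₀-above : P₀ ≡ above + Pᵇ
    P₀-above = trans (S-23 even even odd odd _ _) (trans (S-12 even even odd odd _ _) (trans
      (Split.split-even-odd N<K even odd (λ x t y z → P x y z t) (λ x t y z → y * (x + y))
        (λ x t y z → in₄ (suc y * suc y) _ _ (m≤m*n (suc x) (suc t)))
        (λ x t y z → in₄ (suc y * suc y) _ _ (m≤n*m (suc t) (suc x))))
      (cong (_+ Pᵇ) (trans (S-01 odd odd even odd _ _) (trans (S-12 odd odd even odd _ _)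
        (trans (S-01 odd even odd odd _ _) (S-cong even odd odd odd lemF lemw)))))))
      where
      lemF : ∀ y t x z → y * y + 2 * (y * t) + (t + x) * z + (t + x) * t ≡ x * t + t * z + z * x + (t + y) * (t + y)
      lemF = solve-∀
      lemw : ∀ y t x z → y * (t + x + y) ≡ (x + (t + y)) * y
      lemw = solve-∀

    P₀-P : P₀ ≡ P₁ + P₂
    P₀-P = trans (S-01 even even odd odd _ _) (trans (S-12 even even odd odd _ _)
      (Split.split-even-odd N<K even odd (λ y z x t → P x y z t) (λ y z x t → y * (x + y))
        (λ y z x t → in₁ _ (suc x * suc z) (suc x * suc t) (m≤m*n (suc y) (suc y)))
        (λ y z x t → in₃ (suc y * suc y) _ _ (m≤n*m (suc z) (suc x)))))

    P₂-P : P₂ ≡ P₂₁ + P₂₂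
    P₂-P = trans (S-01 even odd even odd _ _) (trans (S-12 odd even even odd _ _) (trans (S-01 odd even even odd _ _)
      (Split.split-even-odd N<K even odd (λ x z y t → P x y (y + z) t) (λ x z y t → y * (x + y))
        (λ x z y t → in₄ (suc y * suc y) _ _ (m≤m*n (suc x) (suc t)))
        (λ x z y t → in₃ (suc y * suc y) _ _ (≤-trans (m≤n+m _ (suc y)) (m≤n*m _ (suc x)))))))

    -- The cutting stops here because P is self-similar: raising z by x + 2y has the same effect as
    -- raising t by x. Thus the last piece is `Pᵇ` again, the very part of `P₀` outside `above`, and
    -- it cancels.
    P₂₂-P : P₂₂ ≡ P₂₂₁ + Pᵇ
    P₂₂-P = trans (S-01 even odd even odd _ _) (trans (S-12 odd even even odd _ _) (trans (S-01 odd even even odd _ _)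
      (trans (Split.split-even-odd N<K even odd (λ y z x t → P x y (y + (x + z)) t) (λ y z x t → y * (x + y))
        (λ y z x t → in₁ _ (suc x * _) (suc x * suc t) (m≤m*n (suc y) (suc y)))
        (λ y z x t → in₃ (suc y * suc y) _ _ (≤-trans (m≤n+m _ (suc x)) (≤-trans (m≤n+m _ (suc y)) (m≤n*m _ (suc x))))))
      (cong (P₂₂₁ +_) (trans (S-01 even odd even odd _ _) (trans (S-12 odd even even odd _ _) (trans (S-01 odd even even odd _ _)
        (trans (S-23 even odd even odd _ _) (trans (S-12 even odd odd even _ _) (trans (S-23 even odd odd even _ _)
          (S-cong even odd even odd lemF λ _ _ _ _ → refl)))))))))))
      where
      lemF : ∀ x t y z → y * y + 2 * (y * t) + x * (y + (x + (y + z))) + x * t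
                       ≡ y * y + 2 * (y * (x + t)) + x * z + x * (x + t)
      lemF = solve-∀

    P₁≡Q₁₁ : P₁ ≡ Q₁₁
    P₁≡Q₁₁ = trans (S-12 odd odd even odd _ _) (trans (S-01 odd even odd odd _ _) (S-cong even odd odd odd lemF lemw))
      where
      lemF : ∀ x y z t → (z + y) * (z + y) + 2 * ((z + y) * t) + x * z + x * t
                       ≡ z * (y + (z + (y + x))) + (y + (z + (y + x))) * t + t * z + y * y
      lemF = solve-∀
      lemw : ∀ x y z t → (z + y) * (x + (z + y)) ≡ (z + y) * (z + (y + x))
      lemw = solve-∀

    P₂₁≡Q₂ : P₂₁ ≡ Q₂
    P₂₁≡Q₂ = trans (S-12 odd odd even odd _ _) (trans (S-01 odd even odd odd _ _) (S-cong even odd odd odd lemF lemw))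
      where
      lemF : ∀ y x z t → y * y + 2 * (y * t) + (z + x) * (y + z) + (z + x) * t
                       ≡ (y + x) * (z + y) + (z + y) * t + t * (y + x) + z * z
      lemF = solve-∀
      lemw : ∀ y x z t → y * (z + x + y) ≡ (y + x + z) * y
      lemw = solve-∀

    P₂₂₁≡Q₁₂ : P₂₂₁ ≡ Q₁₂
    P₂₂₁≡Q₁₂ = trans (S-01 odd odd even odd _ _) (trans (S-12 odd odd even odd _ _) (S-cong odd even odd odd lemF lemw))
      where
      lemF : ∀ z x y t → (z + y) * (z + y) + 2 * ((z + y) * t) + x * (z + y + (x + z)) + x * t
                       ≡ y * (z + x + (y + z)) + (z + x + (y + z)) * t + t * y + (z + x) * (z + x)
      lemF = solve-∀
      lemw : ∀ z x y t → (z + y) * (x + (z + y)) ≡ (y + (z + x)) * (y + z)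
      lemw = solve-∀

    above≡below : above ≡ below
    above≡below = +-cancelʳ-≡ Pᵇ above below (begin
      above + Pᵇ                      ≡⟨ P₀-above ⟨
      P₀                              ≡⟨ P₀-P ⟩
      P₁ + P₂                         ≡⟨ cong (P₁ +_) (trans P₂-P (cong (P₂₁ +_) P₂₂-P)) ⟩
      P₁ + (P₂₁ + (P₂₂₁ + Pᵇ))        ≡⟨ cong₂ _+_ P₁≡Q₁₁ (cong₂ _+_ P₂₁≡Q₂ (cong (_+ Pᵇ) P₂₂₁≡Q₁₂)) ⟩
      Q₁₁ + (Q₂ + (Q₁₂ + Pᵇ))         ≡⟨ lem Q₁₁ Q₂ Q₁₂ Pᵇ ⟩
      Q₁₁ + Q₁₂ + Q₂ + Pᵇ             ≡⟨ cong (λ q → q + Q₂ + Pᵇ) Q₁-Q ⟨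
      Q₁ + Q₂ + Pᵇ                    ≡⟨ cong (_+ Pᵇ) below-Q ⟨
      below + Pᵇ                      ∎)
      where
      open ≡-Reasoning
      lem : ∀ a b c d → a + (b + (c + d)) ≡ a + c + b + d
      lem = solve-∀

    Σ₄ : Fun₄ → ℕ
    Σ₄ = S odd odd odd odd W

    -- The weights differ by (R + κ)(κ - S), which is zero on the diagonal, (R + κ)k for κ = S + k
    -- and -(R + κ)s for S = κ + s. So the claim amounts to `above≡below`.
    κR≡SR : Σ₄ (λ κ S R T → (R + κ) * κ) ≡ Σ₄ (λ κ S R T → (R + κ) * S)
    κR≡SR = begin
      Σ₄ (λ κ S R T → (R + κ) * κ)    ≡⟨ split (λ κ S R T → (R + κ) * κ) ⟩
      D + a′ + b                      ≡⟨ cong (λ x → D + x + b) (trans (S-cong even odd odd odd (λ _ _ _ _ → refl) lem₁)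
                                                                       (S-+ even odd odd odd _ _ _)) ⟩
      D + (a + above) + b             ≡⟨ cong (λ x → D + (a + x) + b) above≡below ⟩
      D + (a + below) + b             ≡⟨ lem₀ D a below b ⟩
      D + a + (b + below)             ≡⟨ cong (D + a +_) (trans (sym (S-+ odd even odd odd _ _ _))
                                                                (S-cong odd even odd odd (λ _ _ _ _ → refl) lem₂)) ⟩
      D + a + b′                      ≡⟨ split (λ κ S R T → (R + κ) * S) ⟨
      Σ₄ (λ κ S R T → (R + κ) * S)    ∎
      where
      open ≡-Reasoning
      split : ∀ w → Σ₄ w ≡ S₃ odd odd odd (λ x → W x x) (λ x → w x x)
                         + S even odd odd odd (λ k S → W (S + k) S) (λ k S → w (S + k) S)
                         + S odd even odd odd (λ κ s → W κ (κ + s)) (λ κ s → w κ (κ + s))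
      split w = Split.split-odd-odd N<K odd odd W w
        (λ κ S R T → in₄ (suc R * suc S) _ _ (m≤m*n (suc κ) (suc κ)))
        (λ κ S R T → in₁ _ _ _ (m≤n*m (suc S) (suc R)))
      D a a′ b b′ : ℕ
      D = S₃ odd odd odd (λ x → W x x) (λ x R T → (R + x) * x)
      a = S even odd odd odd (λ k S → W (S + k) S) (λ k S R T → (R + (S + k)) * S)
      a′ = S even odd odd odd (λ k S → W (S + k) S) (λ k S R T → (R + (S + k)) * (S + k))
      b = S odd even odd odd (λ κ s → W κ (κ + s)) (λ κ s R T → (R + κ) * κ)
      b′ = S odd even odd odd (λ κ s → W κ (κ + s)) (λ κ s R T → (R + κ) * (κ + s))
      lem₀ : ∀ d a x b → d + (a + x) + b ≡ d + a + (b + x)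
      lem₀ = solve-∀
      lem₁ : ∀ k S R T → (R + (S + k)) * (S + k) ≡ (R + (S + k)) * S + (R + (S + k)) * k
      lem₁ k S R T = *-distribˡ-+ (R + (S + k)) S k
      lem₂ : ∀ κ s R T → (R + κ) * κ + (R + κ) * s ≡ (R + κ) * (κ + s)
      lem₂ κ s R T = sym (*-distribˡ-+ (R + κ) κ s)

    -- Expanding `κR≡SR` leaves the mixed terms Rκ and Sκ, whose sums agree because W is symmetric
    -- in R and S.
    Σκκ≡ΣRS : Σ₄ (λ κ S R T → κ * κ) ≡ Σ₄ (λ κ S R T → R * S)
    Σκκ≡ΣRS = +-cancelˡ-≡ (Σ₄ λ κ S R T → R * κ) _ _ (begin
      Σ₄ (λ κ S R T → R * κ) + Σ₄ (λ κ S R T → κ * κ)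
        ≡⟨ S-+ odd odd odd odd _ _ _ ⟨
      Σ₄ (λ κ S R T → R * κ + κ * κ)
        ≡⟨ S-cong odd odd odd odd (λ _ _ _ _ → refl) (λ κ S R T → sym (*-distribʳ-+ κ R κ)) ⟩
      Σ₄ (λ κ S R T → (R + κ) * κ)
        ≡⟨ κR≡SR ⟩
      Σ₄ (λ κ S R T → (R + κ) * S)
        ≡⟨ S-cong odd odd odd odd (λ _ _ _ _ → refl) (λ κ S R T → lem κ S R) ⟩
      Σ₄ (λ κ S R T → S * κ + R * S)
        ≡⟨ S-+ odd odd odd odd _ _ _ ⟩
      Σ₄ (λ κ S R T → S * κ) + Σ₄ (λ κ S R T → R * S)
        ≡⟨ cong (_+ Σ₄ (λ κ S R T → R * S)) (trans (S-12 odd odd odd odd _ _)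
             (S-cong odd odd odd odd symW (λ _ _ _ _ → refl))) ⟩
      Σ₄ (λ κ S R T → R * κ) + Σ₄ (λ κ S R T → R * S) ∎)
      where
      open ≡-Reasoning
      lem : ∀ κ S R → (R + κ) * S ≡ S * κ + R * S
      lem = solve-∀
      symW : ∀ κ R S T → R * S + S * T + T * R + κ * κ ≡ S * R + R * T + T * S + κ * κ
      symW = solve-∀

    -- Summing the form over its own solutions gives N times their number, and each of its four
    -- terms contributes as much as κ².
    W-moment : (4 + 8 * m) * Σ₄ (λ _ _ _ _ → 1) ≡ 4 * Σ₄ (λ κ S R T → κ * κ)
    W-moment = begin
      N * Σ₄ (λ _ _ _ _ → 1)                ≡⟨ S-*ˡ odd odd odd odd N W (λ _ _ _ _ → 1) ⟨
      Σ₄ (λ _ _ _ _ → N * 1)                ≡⟨ S-cong odd odd odd odd (λ _ _ _ _ → refl) (λ _ _ _ _ → *-identityʳ N) ⟩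
      Σ₄ (λ _ _ _ _ → N)                    ≡⟨ S-self odd odd odd odd W ⟨
      Σ₄ W                                  ≡⟨ S-+ odd odd odd odd _ _ _ ⟩
      Σ₄ (λ κ S R T → R * S + S * T + T * R) + κκ
                                            ≡⟨ cong (_+ κκ) (S-+ odd odd odd odd _ _ _) ⟩
      Σ₄ (λ κ S R T → R * S + S * T) + Σ₄ (λ κ S R T → T * R) + κκ
                                            ≡⟨ cong (λ z → z + Σ₄ (λ κ S R T → T * R) + κκ) (S-+ odd odd odd odd _ _ _) ⟩
      RS + Σ₄ (λ κ S R T → S * T) + Σ₄ (λ κ S R T → T * R) + κκ
                                            ≡⟨ cong₂ (λ y z → RS + y + z + κκ) ST≡RS TR≡RS ⟩
      RS + RS + RS + κκ                     ≡⟨ cong (λ z → z + z + z + κκ) Σκκ≡ΣRS ⟨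
      κκ + κκ + κκ + κκ                     ≡⟨ lem κκ ⟩
      4 * κκ                                ∎
      where
      open ≡-Reasoning
      N κκ RS : ℕ
      N = 4 + 8 * m
      κκ = Σ₄ (λ κ S R T → κ * κ)
      RS = Σ₄ (λ κ S R T → R * S)
      lem : ∀ x → x + x + x + x ≡ 4 * x
      lem = solve-∀
      symRT : ∀ κ S T R → R * S + S * T + T * R + κ * κ ≡ T * S + S * R + R * T + κ * κ
      symRT = solve-∀
      symST : ∀ κ T R S → R * S + S * T + T * R + κ * κ ≡ R * T + T * S + S * R + κ * κ
      symST = solve-∀
      ST≡RS : Σ₄ (λ κ S R T → S * T) ≡ RS
      ST≡RS = trans (S-23 odd odd odd odd _ _) (S-cong odd odd odd odd symRT (λ _ S R _ → *-comm S R))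
      TR≡RS : Σ₄ (λ κ S R T → T * R) ≡ RS
      TR≡RS = trans (S-12 odd odd odd odd _ _) (trans (S-23 odd odd odd odd _ _) (trans (S-12 odd odd odd odd _ _)
        (S-cong odd odd odd odd symST (λ _ S R _ → *-comm S R))))

-- Equality of the two counts, and sums of three odd squares.

module OddSquares where

  open Summation
  open Counting
  open ProductForm using (half-pronic; module Ternary)
  open import Data.Empty using (⊥-elim)
  open import Data.Nat.Base
  open import Data.Nat.Properties
  open import Data.Nat.Induction using (<-rec)
  open import Data.Nat.Tactic.RingSolver using (solve-∀)
  open import Data.Product using (∃; _×_; _,_)
  open import Function.Base using (_∘_)
  open import Relation.Binary.PropositionalEquality
  open import Relation.Nullary using (yes; no)

  Fun₃ : Set
  Fun₃ = ℕ → ℕ → ℕ → ℕ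

  squares products : Fun₃
  squares  x y z = x * x + y * y + z * z
  products x y z = x * y + y * z + z * x

  fibre : ℕ → ℕ → Fun₃ → ℕ → ℕ
  fibre K N G κ = Weighted.fibre K N G κ

  odd-square : ∀ i → ∃ λ t → (odd # i) * (odd # i) ≡ 8 * t + 1
  odd-square i with half-pronic i
  ... | t , e = t , trans (lem₁ i) (trans (cong (λ z → 4 * z + 1) e) (lem₂ t))
    where
    lem₁ : ∀ i → (1 + (i + i)) * (1 + (i + i)) ≡ 4 * (i * (1 + i)) + 1
    lem₁ = solve-∀
    lem₂ : ∀ t → 4 * (2 * t) + 1 ≡ 8 * t + 1
    lem₂ = solve-∀

  module Moments (K : ℕ) where

    -- The zero sum of κ² - M for M = 1 + 2m, multiplied by 4 and freed of subtraction. One K serves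
    -- all m with N < K, since the recursion compares counts for different m.
    Balanced : Fun₃ → Set
    Balanced G = ∀ m → 4 + 8 * m < K →
      (4 + 8 * m) * ∑ K (λ i → fibre K (4 + 8 * m) G (odd # i)) ≡
      4 * ∑ K (λ i → (odd # i) * (odd # i) * fibre K (4 + 8 * m) G (odd # i))

    -- The excess 8t of κ² over 1 cancels against N = 4 + 8m, so κ at m behaves like 1 at m - t.
    fibre-lower : ∀ G m t κ → κ * κ ≡ 8 * t + 1 → t ≤ m →
      fibre K (4 + 8 * m) G κ ≡ fibre K (4 + 8 * (m ∸ t)) G 1
    fibre-lower G m t κ e t≤m = ∑-cong K λ j → ∑-cong K λ k → ∑-cong K λ l →
      trans (cong₂ (λ n s → χ n s 1)
              (trans (cong (λ z → 4 + 8 * z) (sym (m+[n∸m]≡n t≤m))) (lem₁ t (m ∸ t)))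
              (trans (cong (_+ G (odd # j) (odd # k) (odd # l)) e) (+-assoc (8 * t) 1 _)))
            (χ-+ˡ (8 * t) (4 + 8 * (m ∸ t)) _ 1)
      where
      lem₁ : ∀ t u → 4 + 8 * (t + u) ≡ 8 * t + (4 + 8 * u)
      lem₁ = solve-∀

    fibre-empty : ∀ G m t κ → κ * κ ≡ 8 * t + 1 → m < t → fibre K (4 + 8 * m) G κ ≡ 0
    fibre-empty G m t κ e m<t = ∑-zero K λ j _ → ∑-zero K λ k _ → ∑-zero K λ l _ →
      χ-≢ (4 + 8 * m) 1 λ p → <-irrefl (sym p) (begin-strict
        4 + 8 * m                                      <⟨ +-monoˡ-< (8 * m) {4} {8} (s≤s (s≤s (s≤s (s≤s (s≤s z≤n))))) ⟩
        8 + 8 * m                                      ≡⟨ *-suc 8 m ⟨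
        8 * suc m                                      ≤⟨ *-monoʳ-≤ 8 m<t ⟩
        8 * t                                          ≤⟨ m≤m+n (8 * t) 1 ⟩
        8 * t + 1                                      ≡⟨ e ⟨
        κ * κ                                          ≤⟨ m≤m+n (κ * κ) _ ⟩
        κ * κ + G (odd # j) (odd # k) (odd # l)        ∎)
      where open ≤-Reasoning

    module _ (G H : Fun₃) (bG : Balanced G) (bH : Balanced H)
      (base : fibre K 4 G 1 ≡ fibre K 4 H 1) where

      fibre-unique : ∀ m → 4 + 8 * m < K → fibre K (4 + 8 * m) G 1 ≡ fibre K (4 + 8 * m) H 1
      fibre-unique = <-rec _ step
        where
        step : ∀ m → (∀ {m′} → m′ < m → 4 + 8 * m′ < K → fibre K (4 + 8 * m′) G 1 ≡ fibre K (4 + 8 * m′) H 1) →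
               4 + 8 * m < K → fibre K (4 + 8 * m) G 1 ≡ fibre K (4 + 8 * m) H 1
        step zero    rec _   = base
        step (suc n) rec N<K = first K N<K (bG m N<K) (bH m N<K)
          where
          m N : ℕ
          m = suc n
          N = 4 + 8 * m
          fG fH : ℕ → ℕ
          fG i = fibre K N G (odd # i)
          fH i = fibre K N H (odd # i)
          higher : ∀ i → fG (suc i) ≡ fH (suc i)
          higher i with odd-square (suc i)
          ... | zero  , e with suc-injective e
          ...   | ()
          higher i | suc t , e with suc t ≤? m
          ... | no  t≰m = trans (fibre-empty G m (suc t) (odd # suc i) e (≰⇒> t≰m))
                                (sym (fibre-empty H m (suc t) (odd # suc i) e (≰⇒> t≰m)))
          ... | yes t≤m = trans (fibre-lower G m (suc t) (odd # suc i) e t≤m)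
            (trans (rec (s≤s (m∸n≤m n t)) (≤-<-trans (+-monoʳ-≤ 4 (*-monoʳ-≤ 8 (m∸n≤m m (suc t)))) N<K))
                   (sym (fibre-lower H m (suc t) (odd # suc i) e t≤m)))
          -- The outer cutoff is generalised so that it can be matched as a successor and the term κ
          -- = 1 split off. The coefficient of that term is N - 4 = 8m, positive here; adding one
          -- balance equation to the other reversed isolates it without subtraction.
          first : ∀ K′ → N < K′ →
            N * ∑ K′ fG ≡ 4 * ∑ K′ (λ i → (odd # i) * (odd # i) * fG i) →
            N * ∑ K′ fH ≡ 4 * ∑ K′ (λ i → (odd # i) * (odd # i) * fH i) → fG 0 ≡ fH 0
          first (suc K′) _ eG eH = *-cancelˡ-≡ (fG 0) (fH 0) (8 * m) (+-cancelˡ-≡ c _ _ (begin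
            c + 8 * m * fG 0                ≡⟨ lem m (fG 0) (fH 0) t x ⟩
            N * (fG 0 + t) + 4 * (fH 0 + x) ≡⟨ cong₂ _+_ (trans (cong (λ z → N * (fG 0 + z)) (∑-cong K′ (sym ∘ higher))) eG′) (sym eH′) ⟩
            4 * (fG 0 + x) + N * (fH 0 + t) ≡⟨ lem′ m (fG 0) (fH 0) t x ⟩
            c + 8 * m * fH 0                ∎))
            where
            open ≡-Reasoning
            t x c : ℕ
            t = ∑ K′ (fH ∘ suc)
            x = ∑ K′ (λ i → (odd # suc i) * (odd # suc i) * fH (suc i))
            c = 4 * (fG 0 + fH 0) + N * t + 4 * x
            eG′ : N * (fG 0 + ∑ K′ (fG ∘ suc)) ≡ 4 * (fG 0 + x)
            eG′ = trans eG (cong (4 *_) (cong₂ _+_ (*-identityˡ (fG 0))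
              (∑-cong K′ (λ i → cong ((odd # suc i) * (odd # suc i) *_) (higher i)))))
            eH′ : N * (fH 0 + t) ≡ 4 * (fH 0 + x)
            eH′ = trans eH (cong (4 *_) (cong (_+ x) (*-identityˡ (fH 0))))
            lem : ∀ m g h t x → 4 * (g + h) + (4 + 8 * m) * t + 4 * x + 8 * m * g
                              ≡ (4 + 8 * m) * (g + t) + 4 * (h + x)
            lem = solve-∀
            lem′ : ∀ m g h t x → 4 * (g + x) + (4 + 8 * m) * (h + t)
                               ≡ 4 * (g + h) + (4 + 8 * m) * t + 4 * x + 8 * m * h
            lem′ = solve-∀

    module _ (m : ℕ) (N<K : 4 + 8 * m < K) where

      open Weighted K (4 + 8 * m)

      E : Fun₃ → Fun₄
      E G κ x y z = κ * κ + G x y z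

      products-moment : (4 + 8 * m) * S odd odd odd odd (E products) (λ _ _ _ _ → 1)
                      ≡ 4 * S odd odd odd odd (E products) (λ κ _ _ _ → κ * κ)
      products-moment = subst₂ (λ a b → (4 + 8 * m) * a ≡ 4 * b)
        (S-cong odd odd odd odd lem (λ _ _ _ _ → refl)) (S-cong odd odd odd odd lem (λ _ _ _ _ → refl))
        (Ternary.W-moment K m N<K)
        where
        lem : ∀ κ S R T → R * S + S * T + T * R + κ * κ ≡ κ * κ + (S * R + R * T + T * S)
        lem = solve-∀

      squares-moment : (4 + 8 * m) * S odd odd odd odd (E squares) (λ _ _ _ _ → 1)
                     ≡ 4 * S odd odd odd odd (E squares) (λ κ _ _ _ → κ * κ)
      squares-moment = begin
        N * Σ₄ (λ _ _ _ _ → 1)                ≡⟨ S-*ˡ odd odd odd odd N (E squares) (λ _ _ _ _ → 1) ⟨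
        Σ₄ (λ _ _ _ _ → N * 1)                ≡⟨ S-cong odd odd odd odd (λ _ _ _ _ → refl) (λ _ _ _ _ → *-identityʳ N) ⟩
        Σ₄ (λ _ _ _ _ → N)                    ≡⟨ S-self odd odd odd odd (E squares) ⟨
        Σ₄ (E squares)                        ≡⟨ S-+ odd odd odd odd _ _ _ ⟩
        κκ + Σ₄ (λ κ x y z → squares x y z)   ≡⟨ cong (κκ +_) (S-+ odd odd odd odd _ _ _) ⟩
        κκ + (Σ₄ (λ κ x y z → x * x + y * y) + zz)
                                              ≡⟨ cong (λ s → κκ + (s + zz)) (S-+ odd odd odd odd _ _ _) ⟩
        κκ + (xx + yy + zz)                   ≡⟨ cong (κκ +_) (cong₂ _+_ (cong₂ _+_ xx≡κκ yy≡κκ) zz≡κκ) ⟩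
        κκ + (κκ + κκ + κκ)                   ≡⟨ lem κκ ⟩
        4 * κκ                                ∎
        where
        open ≡-Reasoning
        Σ₄ : Fun₄ → ℕ
        Σ₄ = S odd odd odd odd (E squares)
        N κκ xx yy zz : ℕ
        N = 4 + 8 * m
        κκ = Σ₄ (λ κ x y z → κ * κ)
        xx = Σ₄ (λ κ x y z → x * x)
        yy = Σ₄ (λ κ x y z → y * y)
        zz = Σ₄ (λ κ x y z → z * z)
        lem : ∀ x → x + (x + x + x) ≡ 4 * x
        lem = solve-∀
        sym₀₁ : ∀ κ x y z → x * x + (κ * κ + y * y + z * z) ≡ κ * κ + (x * x + y * y + z * z)
        sym₀₁ = solve-∀
        sym₁₂ : ∀ κ x y z → κ * κ + (y * y + x * x + z * z) ≡ κ * κ + (x * x + y * y + z * z)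
        sym₁₂ = solve-∀
        sym₂₃ : ∀ κ x y z → κ * κ + (x * x + z * z + y * y) ≡ κ * κ + (x * x + y * y + z * z)
        sym₂₃ = solve-∀
        xx≡κκ : xx ≡ κκ
        xx≡κκ = trans (S-01 odd odd odd odd _ _) (S-cong odd odd odd odd sym₀₁ (λ _ _ _ _ → refl))
        yy≡κκ : yy ≡ κκ
        yy≡κκ = trans (S-12 odd odd odd odd _ _)
          (trans (S-cong odd odd odd odd sym₁₂ (λ _ _ _ _ → refl)) xx≡κκ)
        zz≡κκ : zz ≡ κκ
        zz≡κκ = trans (S-23 odd odd odd odd _ _)
          (trans (S-cong odd odd odd odd sym₂₃ (λ _ _ _ _ → refl)) yy≡κκ)

    balance : ∀ (G : Fun₃) → (∀ m → 4 + 8 * m < K → (4 + 8 * m) * Weighted.S K (4 + 8 * m) odd odd odd odd (λ κ x y z → κ * κ + G x y z) (λ _ _ _ _ → 1)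
                      ≡ 4 * Weighted.S K (4 + 8 * m) odd odd odd odd (λ κ x y z → κ * κ + G x y z) (λ κ _ _ _ → κ * κ)) →
              Balanced G
    balance G e m N<K = subst₂ (λ a b → (4 + 8 * m) * a ≡ 4 * b)
      (trans (Weighted.S-fibre K (4 + 8 * m) G (λ _ → 1)) (∑-cong K (λ i → *-identityˡ (fibre K (4 + 8 * m) G (odd # i)))))
      (Weighted.S-fibre K (4 + 8 * m) G (λ κ → κ * κ))
      (e m N<K)

    fibre-4 : ∀ (G : Fun₃) → (∀ x y z → suc x + suc y + suc z ≤ G (suc x) (suc y) (suc z)) → ∀ j k l →
      1 + G (odd # j) (odd # k) (odd # l) ≡ 4 → j ≡ 0 × k ≡ 0 × l ≡ 0
    fibre-4 G G≥ j k l e = m+n≡0⇒m≡0 j j+k≡0 , m+n≡0⇒n≡0 j j+k≡0 , m+n≡0⇒n≡0 (j + k) j+k+l≡0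
      where
      bound : 2 * (j + k + l) + 3 ≤ 3
      bound = ≤-trans (≤-reflexive (lem j k l)) (≤-trans (G≥ (j + j) (k + k) (l + l)) (≤-reflexive (suc-injective e)))
        where
        lem : ∀ j k l → 2 * (j + k + l) + 3 ≡ 1 + (j + j) + (1 + (k + k)) + (1 + (l + l))
        lem = solve-∀
      j+k+l≡0 : j + k + l ≡ 0
      j+k+l≡0 = n≤0⇒n≡0 (≤-trans (m≤n*m (j + k + l) 2) (+-cancelʳ-≤ 3 (2 * (j + k + l)) 0 bound))
      j+k≡0 : j + k ≡ 0
      j+k≡0 = m+n≡0⇒m≡0 (j + k) j+k+l≡0

    base : fibre K 4 squares 1 ≡ fibre K 4 products 1
    base = ∑-cong K λ j → ∑-cong K λ k → ∑-cong K λ l → pointwise j k l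
      where
      sq≥ : ∀ x y z → suc x + suc y + suc z ≤ squares (suc x) (suc y) (suc z)
      sq≥ x y z = +-mono-≤ (+-mono-≤ (m≤m*n (suc x) (suc x)) (m≤m*n (suc y) (suc y))) (m≤m*n (suc z) (suc z))
      pr≥ : ∀ x y z → suc x + suc y + suc z ≤ products (suc x) (suc y) (suc z)
      pr≥ x y z = +-mono-≤ (+-mono-≤ (m≤m*n (suc x) (suc y)) (m≤m*n (suc y) (suc z))) (m≤m*n (suc z) (suc x))
      pointwise : ∀ j k l → χ 4 (1 + squares (odd # j) (odd # k) (odd # l)) 1
                          ≡ χ 4 (1 + products (odd # j) (odd # k) (odd # l)) 1
      pointwise j k l with 1 + squares (odd # j) (odd # k) (odd # l) ≟ 4
      ... | yes e with fibre-4 squares sq≥ j k l e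
      ...   | refl , refl , refl = refl
      pointwise j k l | no n with 1 + products (odd # j) (odd # k) (odd # l) ≟ 4
      ...   | no n′ = trans (χ-≢ 4 1 n) (sym (χ-≢ 4 1 n′))
      ...   | yes e with fibre-4 products pr≥ j k l e
      ...     | refl , refl , refl = ⊥-elim (n refl)

    squares≡products : ∀ m → 4 + 8 * m < K → fibre K (4 + 8 * m) squares 1 ≡ fibre K (4 + 8 * m) products 1
    squares≡products = fibre-unique squares products
      (balance squares squares-moment) (balance products products-moment) base

  fibre-solution : ∀ K N G → fibre K (suc N) G 1 ≢ 0 →
    ∃ λ i → ∃ λ j → ∃ λ k → G (odd # i) (odd # j) (odd # k) ≡ N
  fibre-solution K N G nz with ∑≢0⇒∃ K _ nz
  ... | i , p with ∑≢0⇒∃ K _ p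
  ...   | j , q with ∑≢0⇒∃ K _ q
  ...     | k , r = i , j , k , suc-injective (χ-≢0 (suc N) r)

  three-odd-squares : ∀ m → ∃ λ i → ∃ λ j → ∃ λ k → squares (odd # i) (odd # j) (odd # k) ≡ 3 + 8 * m
  three-odd-squares m = fibre-solution K (3 + 8 * m) squares positive
    where
    N K : ℕ
    N = 4 + 8 * m
    K = suc N
    2m<K : 2 * m < K
    2m<K = s≤s (≤-trans (*-monoˡ-≤ m {2} {8} (s≤s (s≤s z≤n))) (m≤n+m (8 * m) 4))
    -- The visible solution (1, 1, 4m + 1): 1 + 2(4m + 1) = 3 + 8m.
    term : χ N (1 + products 1 1 (odd # (2 * m))) 1 ≡ 1
    term = trans (cong (λ s → χ N s 1) (lem m)) (χ-≡ N 1)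
      where
      lem : ∀ m → 1 + (1 * 1 + 1 * (1 + (2 * m + 2 * m)) + (1 + (2 * m + 2 * m)) * 1) ≡ 4 + 8 * m
      lem = solve-∀
    1≤ : 1 ≤ fibre K N products 1
    1≤ = begin
      1                                         ≡⟨ term ⟨
      χ N (1 + products 1 1 (odd # (2 * m))) 1  ≤⟨ ∑-term≤ K (λ l → χ N (1 + products 1 1 (odd # l)) 1) (2 * m) 2m<K ⟩
      ∑ K (λ l → χ N (1 + products 1 1 (odd # l)) 1)
        ≤⟨ ∑-term≤ K (λ k → ∑ K λ l → χ N (1 + products 1 (odd # k) (odd # l)) 1) 0 z<s ⟩
      ∑ K (λ k → ∑ K λ l → χ N (1 + products 1 (odd # k) (odd # l)) 1)
        ≤⟨ ∑-term≤ K (λ j → ∑ K λ k → ∑ K λ l → χ N (1 + products (odd # j) (odd # k) (odd # l)) 1) 0 z<s ⟩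
      fibre K N products 1                      ∎
      where open ≤-Reasoning
    positive : fibre K N squares 1 ≢ 0
    positive e = <-irrefl (sym (trans (sym (Moments.squares≡products K m ≤-refl)) e)) 1≤

-- Necessary conditions on sum and square sum, and four numbers with odd sum.

module Representation where

  open Counting using (_#_; odd)
  open OddSquares using (squares; three-odd-squares)
  open import Data.Nat.Base as ℕ using (ℕ; suc; s≤s; z≤n)
  import Data.Nat.Tactic.RingSolver as ℕ-Solver
  open import Data.Integer.Base hiding (suc; pred)
  open import Data.Integer.Properties
  open import Data.Integer.DivMod using (_%ℕ_; _/ℕ_; n%ℕd<d; a≡a%ℕn+[a/ℕn]*n)
  open import Data.Integer.Tactic.RingSolver using (solve-∀)
  open import Data.Product using (Σ; ∃; _×_; _,_)
  open import Data.Vec.Base using (Vec; []; _∷_)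
  open import Relation.Binary.PropositionalEquality

  -- The square sum is an integer here because a part s is split off before ν - s² is known to be
  -- nonnegative.
  Rep : ℕ → ℤ → ℤ → Set
  Rep m ν τ = Σ (Vec ℤ m) λ x → sumℤ x ≡ τ × sumSqℤ x ≡ ν

  add-part : ∀ {m} ν τ s → Rep m (ν - s * s) (τ - s) → Rep (suc m) ν τ
  add-part ν τ s (v , e , f) = s ∷ v , trans (cong (λ z → s + z) e) (lem s τ) , trans (cong (λ z → s * s + z) f) (lem (s * s) ν)
    where
    lem : ∀ s τ → s + (τ - s) ≡ τ
    lem = solve-∀

  square-abs : ∀ i → i * i ≡ + (∣ i ∣ ℕ.* ∣ i ∣)
  square-abs (+ n)    = sym (pos-* n n)
  square-abs -[1+ n ] = refl

  0≤i*i : ∀ i → + 0 ≤ i * i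
  0≤i*i i = subst (+ 0 ≤_) (sym (square-abs i)) (+≤+ z≤n)

  -- The deviation ∑ (x - yᵢ)², expanded.
  deviation : ∀ {m} x (v : Vec ℤ m) → + 0 ≤ + m * (x * x) - + 2 * (x * sumℤ v) + sumSqℤ v
  deviation x [] = ≤-reflexive (sym (lem x))
    where
    lem : ∀ x → + 0 * (x * x) - + 2 * (x * + 0) + + 0 ≡ + 0
    lem = solve-∀
  deviation {suc m} x (y ∷ v) = subst (+ 0 ≤_) (lem (+ m) x y (sumℤ v) (sumSqℤ v))
    (+-mono-≤ (0≤i*i (x - y)) (deviation x v))
    where
    lem : ∀ m x y s q → (x - y) * (x - y) + (m * (x * x) - + 2 * (x * s) + q)
                      ≡ (+ 1 + m) * (x * x) - + 2 * (x * (y + s)) + (y * y + q)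
    lem = solve-∀

  -- The difference is the sum of (xᵢ - xⱼ)² over all pairs; prepending x adds the pairs that
  -- involve x, which is `deviation`.
  cauchy-schwarz : ∀ {m} (v : Vec ℤ m) → + 0 ≤ + m * sumSqℤ v - sumℤ v * sumℤ v
  cauchy-schwarz [] = +≤+ z≤n
  cauchy-schwarz {suc m} (x ∷ v) = subst (+ 0 ≤_) (lem (+ m) x (sumℤ v) (sumSqℤ v))
    (+-mono-≤ (cauchy-schwarz v) (deviation x v))
    where
    lem : ∀ m x s q → (m * q - s * s) + (m * (x * x) - + 2 * (x * s) + q)
                    ≡ (+ 1 + m) * (x * x + q) - (x + s) * (x + s)
    lem = solve-∀

  pronic : ∀ x → ∃ λ h → x * x + x ≡ + 2 * h
  pronic x with x %ℕ 2 | n%ℕd<d x 2 | a≡a%ℕn+[a/ℕn]*n x 2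
  ... | 0 | _ | e = q * (+ 2 * q + + 1) , trans (cong (λ z → z * z + z) e) (lem q)
    where
    q : ℤ
    q = x /ℕ 2
    lem : ∀ q → (+ 0 + q * + 2) * (+ 0 + q * + 2) + (+ 0 + q * + 2) ≡ + 2 * (q * (+ 2 * q + + 1))
    lem = solve-∀
  ... | 1 | _ | e = (+ 2 * q + + 1) * (q + + 1) , trans (cong (λ z → z * z + z) e) (lem q)
    where
    q : ℤ
    q = x /ℕ 2
    lem : ∀ q → (+ 1 + q * + 2) * (+ 1 + q * + 2) + (+ 1 + q * + 2) ≡ + 2 * ((+ 2 * q + + 1) * (q + + 1))
    lem = solve-∀
  ... | suc (suc _) | s≤s (s≤s ()) | _

  parity : ∀ {m} (v : Vec ℤ m) → ∃ λ k → sumSqℤ v ≡ sumℤ v + + 2 * k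
  parity [] = + 0 , refl
  parity (x ∷ v) with pronic x | parity v
  ... | h , e | k , f = h - x + k , (begin
    x * x + sumSqℤ v                             ≡⟨ lem₁ x (sumSqℤ v) ⟩
    (x * x + x) - x + sumSqℤ v                   ≡⟨ cong₂ (λ a b → a - x + b) e f ⟩
    + 2 * h - x + (sumℤ v + + 2 * k)             ≡⟨ lem₂ x (sumℤ v) h k ⟩
    x + sumℤ v + + 2 * (h - x + k)               ∎)
    where
    open ≡-Reasoning
    lem₁ : ∀ x q → x * x + q ≡ (x * x + x) - x + q
    lem₁ = solve-∀
    lem₂ : ∀ x s h k → + 2 * h - x + (s + + 2 * k) ≡ x + s + + 2 * (h - x + k)
    lem₂ = solve-∀

  -- The numbers are (t ± a ± b ± c) / 4 with an even number of minus signs, where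
  -- t, a, b, c are the odd numbers 2j + 1, 2α + 1, 2β + 1, 2γ + 1.
  four : ∀ ν j α β γ δ → j + α + β + γ ≡ + 2 * δ →
    + 4 * ν ≡ (+ 2 * j + + 1) * (+ 2 * j + + 1) + ((+ 2 * α + + 1) * (+ 2 * α + + 1)
              + (+ 2 * β + + 1) * (+ 2 * β + + 1) + (+ 2 * γ + + 1) * (+ 2 * γ + + 1)) →
    Rep 4 ν (+ 2 * j + + 1)
  four ν j α β γ δ e f = x ∷ (x - + 1 - (β + γ)) ∷ (x - + 1 - (α + γ)) ∷ (x - + 1 - (α + β)) ∷ [] ,
    trans (lem₁ α β γ x) (cong (λ z → + 2 * z + + 1) (sym j≡)) ,
    *-cancelˡ-≡ (+ 4) q ν (trans (lem₂ α β γ x) (trans (cong F (sym j≡)) (sym f)))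
    where
    x q : ℤ
    x = δ + + 1
    q = x * x + ((x - + 1 - (β + γ)) * (x - + 1 - (β + γ))
       + ((x - + 1 - (α + γ)) * (x - + 1 - (α + γ)) + ((x - + 1 - (α + β)) * (x - + 1 - (α + β)) + + 0)))
    F : ℤ → ℤ
    F z = (+ 2 * z + + 1) * (+ 2 * z + + 1) + ((+ 2 * α + + 1) * (+ 2 * α + + 1)
              + (+ 2 * β + + 1) * (+ 2 * β + + 1) + (+ 2 * γ + + 1) * (+ 2 * γ + + 1))
    j≡ : j ≡ + 2 * x - + 2 - α - β - γ
    j≡ = trans (lem j α β γ) (trans (cong (λ z → z - α - β - γ) e) (cong (λ z → z - α - β - γ) (lem′ δ)))
      where
      lem : ∀ j α β γ → j ≡ j + α + β + γ - α - β - γ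
      lem = solve-∀
      lem′ : ∀ δ → + 2 * δ ≡ + 2 * (δ + + 1) - + 2
      lem′ = solve-∀
    lem₁ : ∀ α β γ x → x + (x - + 1 - (β + γ) + (x - + 1 - (α + γ) + (x - + 1 - (α + β) + + 0)))
                     ≡ + 2 * (+ 2 * x - + 2 - α - β - γ) + + 1
    lem₁ = solve-∀
    lem₂ : ∀ α β γ x →
      + 4 * (x * x + ((x - + 1 - (β + γ)) * (x - + 1 - (β + γ))
       + ((x - + 1 - (α + γ)) * (x - + 1 - (α + γ)) + ((x - + 1 - (α + β)) * (x - + 1 - (α + β)) + + 0))))
      ≡ (+ 2 * (+ 2 * x - + 2 - α - β - γ) + + 1) * (+ 2 * (+ 2 * x - + 2 - α - β - γ) + + 1)
        + ((+ 2 * α + + 1) * (+ 2 * α + + 1)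
          + (+ 2 * β + + 1) * (+ 2 * β + + 1) + (+ 2 * γ + + 1) * (+ 2 * γ + + 1))
    lem₂ = solve-∀

  from-odd-squares : ∀ ν j m a b c → squares (odd # a) (odd # b) (odd # c) ≡ 3 ℕ.+ 8 ℕ.* m →
    + 4 * ν ≡ (+ 2 * j + + 1) * (+ 2 * j + + 1) + (+ 3 + + 8 * + m) → Rep 4 ν (+ 2 * j + + 1)
  from-odd-squares ν j m a b c sq e =
    choose (i %ℕ 2) (n%ℕd<d i 2) (a≡a%ℕn+[a/ℕn]*n i 2)
    where
    i : ℤ
    i = j + + a + + b + + c
    δ : ℤ
    δ = (j + + a + + b + + c) /ℕ 2
    o : ℤ → ℤ
    o x = (+ 2 * x + + 1) * (+ 2 * x + + 1)
    odd-pos : ∀ i → + (odd # i) ≡ + 2 * + i + + 1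
    odd-pos i = trans (cong +_ (lem i)) (trans (pos-+ (2 ℕ.* i) 1) (cong (λ z → z + + 1) (pos-* 2 i)))
      where
      lem : ∀ i → 1 ℕ.+ (i ℕ.+ i) ≡ 2 ℕ.* i ℕ.+ 1
      lem = ℕ-Solver.solve-∀
    sq-pos : ∀ i → + ((odd # i) ℕ.* (odd # i)) ≡ o (+ i)
    sq-pos i = trans (pos-* (odd # i) (odd # i)) (cong₂ _*_ (odd-pos i) (odd-pos i))
    f : + 4 * ν ≡ o j + (o (+ a) + o (+ b) + o (+ c))
    f = trans e (cong (λ z → o j + z) (begin
      + 3 + + 8 * + m                                ≡⟨ cong (λ z → + 3 + z) (pos-* 8 m) ⟨
      + (3 ℕ.+ 8 ℕ.* m)                              ≡⟨ cong +_ sq ⟨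
      + squares (odd # a) (odd # b) (odd # c)        ≡⟨ cong₂ _+_ (cong₂ _+_ (sq-pos a) (sq-pos b)) (sq-pos c) ⟩
      o (+ a) + o (+ b) + o (+ c)                    ∎))
      where open ≡-Reasoning
    choose : ∀ r → r ℕ.< 2 → j + + a + + b + + c ≡ + r + δ * + 2 → Rep 4 ν (+ 2 * j + + 1)
    choose 0 _ p = four ν j (+ a) (+ b) (+ c) δ (trans p (lem δ)) f
      where
      lem : ∀ δ → + 0 + δ * + 2 ≡ + 2 * δ
      lem = solve-∀
    -- Replacing c by -c - 1 negates the odd number 2c + 1, so its square is kept, while the parity
    -- of j + a + b + c changes.
    choose 1 _ p = four ν j (+ a) (+ b) (- + c - + 1) (δ - + c)
      (trans (lem₁ j (+ a) (+ b) (+ c)) (trans (cong (λ z → z - + 2 * + c - + 1) p) (lem₂ δ (+ c))))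
      (trans f (cong (λ z → o j + (o (+ a) + o (+ b) + z)) (lem₃ (+ c))))
      where
      lem₁ : ∀ j a b c → j + a + b + (- c - + 1) ≡ j + a + b + c - + 2 * c - + 1
      lem₁ = solve-∀
      lem₂ : ∀ δ c → + 1 + δ * + 2 - + 2 * c - + 1 ≡ + 2 * (δ - c)
      lem₂ = solve-∀
      lem₃ : ∀ c → (+ 2 * c + + 1) * (+ 2 * c + + 1) ≡ (+ 2 * (- c - + 1) + + 1) * (+ 2 * (- c - + 1) + + 1)
      lem₃ = solve-∀
    choose (suc (suc _)) (s≤s (s≤s ())) _

  four-odd : ∀ ν j m → + 4 * ν ≡ (+ 2 * j + + 1) * (+ 2 * j + + 1) + (+ 3 + + 8 * + m) → Rep 4 ν (+ 2 * j + + 1)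
  four-odd ν j m e = let a , b , c , sq = three-odd-squares m in from-odd-squares ν j m a b c sq e

-- Five, six and seven squares.

module LargeRank where

  open Representation
  open import Data.Empty using (⊥; ⊥-elim)
  open import Data.Nat.Base as ℕ using (ℕ; suc; s≤s; z≤n)
  import Data.Nat.Properties as ℕₚ
  open import Data.Integer.Base hiding (suc; pred)
  open import Data.Integer.Properties
  open import Data.Integer.DivMod using (_%ℕ_; _/ℕ_; n%ℕd<d; a≡a%ℕn+[a/ℕn]*n)
  open import Data.Integer.Divisibility.Signed using (∣ᵤ⇒∣; ∣⇒∣ᵤ; divides)
  open import Data.Integer.Tactic.RingSolver using (solve-∀)
  open import Data.Product using (∃; _×_; _,_; proj₁; proj₂)
  open import Data.Sum using (_⊎_; inj₁; inj₂)
  open import Data.Vec.Base using ([]; _∷_)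
  open import Function.Bundles using (_⇔_; mk⇔; Equivalence)
  open import Relation.Binary.PropositionalEquality
  open import Relation.Nullary using (yes; no)

  0≤⇒+ : ∀ {i} → + 0 ≤ i → ∃ λ d → i ≡ + d
  0≤⇒+ {+ d} _ = d , refl

  Small : ℤ → Set
  Small r = ∃ λ ρ → r * r ≡ + ρ × ρ ℕ.≤ 9

  tiny : ∀ {ρ} → ρ ℕ.≤ 9 → ∀ x → + ρ ≢ + (10 ℕ.+ x)
  tiny ρ≤9 x e = ℕₚ.<-irrefl (+-injective e) (ℕₚ.≤-trans (s≤s ρ≤9) (ℕₚ.m≤m+n 10 x))

  small : ∀ r {p : ∣ r ∣ ℕ.≤ 3} → Small r
  small r {p} = ∣ r ∣ ℕ.* ∣ r ∣ , square-abs r , ℕₚ.*-mono-≤ p p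

  module Remainder where

    -- The remainder r is taken odd, hence modulo 10 instead of 5, because the four remaining
    -- numbers have the sum τ - s = 4s + r, which has to be odd. The price is the extreme value r =
    -- 5, which also stands for r = -5.
    nearest₁₀ : ∀ τ → ∃ λ s → ∃ λ e → τ ≡ + 5 * s + (+ 2 * e + + 1) × (Small (+ 2 * e + + 1) ⊎ e ≡ + 2)
    nearest₁₀ τ = go (τ %ℕ 10) (n%ℕd<d τ 10) (a≡a%ℕn+[a/ℕn]*n τ 10)
      where
      q : ℤ
      q = τ /ℕ 10
      lem : ∀ q a e → + 5 * a + (+ 2 * e + + 1) + q * + 10 ≡ + 5 * (q * + 2 + a) + (+ 2 * e + + 1)
      lem = solve-∀
      ok : ∀ a e c → c ≡ + 5 * a + (+ 2 * e + + 1) → τ ≡ c + q * + 10 → Small (+ 2 * e + + 1) ⊎ e ≡ + 2 →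
        ∃ λ s → ∃ λ e → τ ≡ + 5 * s + (+ 2 * e + + 1) × (Small (+ 2 * e + + 1) ⊎ e ≡ + 2)
      ok a e c refl p bound = q * + 2 + a , e , trans p (lem q a e) , bound
      1≤3 : 1 ℕ.≤ 3
      1≤3 = s≤s z≤n
      go : ∀ c → c ℕ.< 10 → τ ≡ + c + q * + 10 →
           ∃ λ s → ∃ λ e → τ ≡ + 5 * s + (+ 2 * e + + 1) × (Small (+ 2 * e + + 1) ⊎ e ≡ + 2)
      go 0 _ p = ok -[1+ 0 ] (+ 2) (+ 0) refl p (inj₂ refl)
      go 1 _ p = ok (+ 0) (+ 0) (+ 1) refl p (inj₁ (small (+ 1) {1≤3}))
      go 2 _ p = ok (+ 1) -[1+ 1 ] (+ 2) refl p (inj₁ (small -[1+ 2 ] {ℕₚ.≤-refl}))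
      go 3 _ p = ok (+ 0) (+ 1) (+ 3) refl p (inj₁ (small (+ 3) {ℕₚ.≤-refl}))
      go 4 _ p = ok (+ 1) -[1+ 0 ] (+ 4) refl p (inj₁ (small -[1+ 0 ] {1≤3}))
      go 5 _ p = ok (+ 0) (+ 2) (+ 5) refl p (inj₂ refl)
      go 6 _ p = ok (+ 1) (+ 0) (+ 6) refl p (inj₁ (small (+ 1) {1≤3}))
      go 7 _ p = ok (+ 2) -[1+ 1 ] (+ 7) refl p (inj₁ (small -[1+ 2 ] {ℕₚ.≤-refl}))
      go 8 _ p = ok (+ 1) (+ 1) (+ 8) refl p (inj₁ (small (+ 3) {ℕₚ.≤-refl}))
      go 9 _ p = ok (+ 2) -[1+ 0 ] (+ 9) refl p (inj₁ (small -[1+ 0 ] {1≤3}))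
      go (suc (suc (suc (suc (suc (suc (suc (suc (suc (suc _))))))))))
         (s≤s (s≤s (s≤s (s≤s (s≤s (s≤s (s≤s (s≤s (s≤s (s≤s ())))))))))) _

    nearest : ∀ {m c τ q} → τ ≡ + c + q * + m → c ℕ.≤ m → (c ℕ.≤ 3 ⊎ m ℕ.∸ c ℕ.≤ 3) →
      ∃ λ s → ∃ λ r → τ ≡ + m * s + r × Small r
    nearest {m} {c} {τ} {q} p c≤m (inj₁ c≤3) = q , + c , trans p (lem (+ c) q (+ m)) , small (+ c) {c≤3}
      where
      lem : ∀ c q m → c + q * m ≡ m * q + c
      lem = solve-∀
    nearest {m} {c} {τ} {q} p c≤m (inj₂ m-c≤3) = q + + 1 , - + (m ℕ.∸ c) ,
      trans p (trans (cong (λ z → + c + q * z) m≡) (trans (lem (+ c) q (+ (m ℕ.∸ c))) (cong (λ z → z * (q + + 1) + - + (m ℕ.∸ c)) (sym m≡)))) ,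
      small (- + (m ℕ.∸ c)) {subst (ℕ._≤ 3) (sym (∣-i∣≡∣i∣ (+ (m ℕ.∸ c)))) m-c≤3}
      where
      m≡ : + m ≡ + (m ℕ.∸ c) + + c
      m≡ = cong +_ (sym (ℕₚ.m∸n+n≡m c≤m))
      lem : ∀ c q x → c + q * (x + c) ≡ (x + c) * (q + + 1) + - x
      lem = solve-∀

    nearest₆ : ∀ τ → ∃ λ s → ∃ λ r → τ ≡ + 6 * s + r × Small r
    nearest₆ τ = nearest {6} {τ %ℕ 6} {τ} {τ /ℕ 6} (a≡a%ℕn+[a/ℕn]*n τ 6) (ℕₚ.<⇒≤ (n%ℕd<d τ 6)) (go (τ %ℕ 6))
      where
      go : ∀ c → c ℕ.≤ 3 ⊎ 6 ℕ.∸ c ℕ.≤ 3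
      go c with c ℕₚ.≤? 3
      ... | yes c≤3 = inj₁ c≤3
      ... | no  c≰3 = inj₂ (ℕₚ.∸-monoʳ-≤ 6 (ℕₚ.<⇒≤ (ℕₚ.≰⇒> c≰3)))

    nearest₇ : ∀ τ → ∃ λ s → ∃ λ r → τ ≡ + 7 * s + r × Small r
    nearest₇ τ = nearest {7} {τ %ℕ 7} {τ} {τ /ℕ 7} (a≡a%ℕn+[a/ℕn]*n τ 7) (ℕₚ.<⇒≤ (n%ℕd<d τ 7)) (go (τ %ℕ 7))
      where
      go : ∀ c → c ℕ.≤ 3 ⊎ 7 ℕ.∸ c ℕ.≤ 3
      go c with c ℕₚ.≤? 3
      ... | yes c≤3 = inj₁ c≤3
      ... | no  c≰3 = inj₂ (ℕₚ.∸-monoʳ-≤ 7 (ℕₚ.≰⇒> c≰3))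

  open Remainder

  -- With 4(ν - s²) - (τ - s)² = 3 + 8w and D = 5ν - τ² one has r² = 4D - 5(3 + 8w). So w < 0 forces
  -- r² ≥ 25, that is r = 5 and D = 0, and then five equal numbers do.
  five : ∀ ν τ k → ν ≡ τ + + 2 * k → + 0 ≤ + 5 * ν - τ * τ → Rep 5 ν τ
  five ν τ k ν≡ 0≤D with nearest₁₀ τ | 0≤⇒+ 0≤D
  ... | s , e , τ≡ , bound | d , D≡d = main w refl bound
    where
    j : ℤ
    j = + 2 * s + e
    h g : ∃ λ h → _ ≡ + 2 * h
    h = pronic s
    g = pronic j
    w : ℤ
    -- This is (4(ν - s²) - (τ - s)² - 3) / 8; `h` and `g`, the halves of s² + s and j² + j, spare
    -- the division.
    w = + 3 * s + e + k - proj₁ h - proj₁ g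
    lem₁ : ∀ s e → + 5 * s + (+ 2 * e + + 1) - s ≡ + 2 * (+ 2 * s + e) + + 1
    lem₁ = solve-∀
    t≡ : τ - s ≡ + 2 * j + + 1
    t≡ = trans (cong (λ z → z - s) τ≡) (lem₁ s e)
    u≡ : + 4 * (ν - s * s) ≡ (+ 2 * j + + 1) * (+ 2 * j + + 1) + (+ 3 + + 8 * w)
    u≡ = begin
      + 4 * (ν - s * s)
        ≡⟨ cong (λ z → + 4 * (z - s * s)) (trans ν≡ (cong (λ z → z + + 2 * k) τ≡)) ⟩
      + 4 * (+ 5 * s + (+ 2 * e + + 1) + + 2 * k - s * s)
        ≡⟨ lem₂ s e k ⟩
      + 4 * (+ 6 * s + + 2 * e + + 1 + + 2 * k) - + 4 * (s * s + s)
        ≡⟨ cong (λ z → + 4 * (+ 6 * s + + 2 * e + + 1 + + 2 * k) - + 4 * z) (proj₂ h) ⟩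
      + 4 * (+ 6 * s + + 2 * e + + 1 + + 2 * k) - + 4 * (+ 2 * proj₁ h)
        ≡⟨ lem₃ s e k (proj₁ h) (proj₁ g) ⟩
      + 4 * (+ 2 * proj₁ g) + + 1 + (+ 3 + + 8 * w)
        ≡⟨ cong (λ z → + 4 * z + + 1 + (+ 3 + + 8 * w)) (sym (proj₂ g)) ⟩
      + 4 * (j * j + j) + + 1 + (+ 3 + + 8 * w)
        ≡⟨ cong (λ z → z + (+ 3 + + 8 * w)) (lem₄ j) ⟩
      (+ 2 * j + + 1) * (+ 2 * j + + 1) + (+ 3 + + 8 * w) ∎
      where
      open ≡-Reasoning
      lem₂ : ∀ s e k → + 4 * (+ 5 * s + (+ 2 * e + + 1) + + 2 * k - s * s)
                     ≡ + 4 * (+ 6 * s + + 2 * e + + 1 + + 2 * k) - + 4 * (s * s + s)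
      lem₂ = solve-∀
      lem₃ : ∀ s e k h g → + 4 * (+ 6 * s + + 2 * e + + 1 + + 2 * k) - + 4 * (+ 2 * h)
                         ≡ + 4 * (+ 2 * g) + + 1 + (+ 3 + + 8 * (+ 3 * s + e + k - h - g))
      lem₃ = solve-∀
      lem₄ : ∀ j → + 4 * (j * j + j) + + 1 ≡ (+ 2 * j + + 1) * (+ 2 * j + + 1)
      lem₄ = solve-∀
    r : ℤ
    r = + 2 * e + + 1
    r²≡ : r * r ≡ + 4 * + d - + 5 * (+ 3 + + 8 * w)
    r²≡ = begin
      r * r                                                        ≡⟨ lem₅ s r ν ⟩
      + 4 * (+ 5 * ν - (+ 5 * s + r) * (+ 5 * s + r)) - + 5 * (+ 4 * (ν - s * s) - (+ 5 * s + r - s) * (+ 5 * s + r - s))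
        ≡⟨ cong (λ z → + 4 * (+ 5 * ν - z * z) - + 5 * (+ 4 * (ν - s * s) - (z - s) * (z - s))) (sym τ≡) ⟩
      + 4 * (+ 5 * ν - τ * τ) - + 5 * (+ 4 * (ν - s * s) - (τ - s) * (τ - s))
        ≡⟨ cong₂ (λ y z → + 4 * y - + 5 * z) D≡d
             (trans (cong₂ (λ y z → y - z * z) u≡ t≡) (lem₆ ((+ 2 * j + + 1) * (+ 2 * j + + 1)) (+ 3 + + 8 * w))) ⟩
      + 4 * + d - + 5 * (+ 3 + + 8 * w)                            ∎
      where
      open ≡-Reasoning
      lem₅ : ∀ s r ν → r * r ≡ + 4 * (+ 5 * ν - (+ 5 * s + r) * (+ 5 * s + r))
                               - + 5 * (+ 4 * (ν - s * s) - (+ 5 * s + r - s) * (+ 5 * s + r - s))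
      lem₅ = solve-∀
      lem₆ : ∀ x y → x + y - x ≡ y
      lem₆ = solve-∀
    w-negative : ∀ n → w ≡ -[1+ n ] → r * r ≡ + (25 ℕ.+ (4 ℕ.* d ℕ.+ 40 ℕ.* n))
    w-negative n w≡ = trans r²≡ (trans (cong (λ z → + 4 * + d - + 5 * (+ 3 + + 8 * z)) w≡)
      (trans (lem (+ d) (+ n)) (cong₂ (λ y z → + 25 + (y + z)) (sym (pos-* 4 d)) (sym (pos-* 40 n)))))
      where
      lem : ∀ d n → + 4 * d - + 5 * (+ 3 + + 8 * (- (+ 1 + n))) ≡ + 25 + (+ 4 * d + + 40 * n)
      lem = solve-∀
    w-nonneg : ∀ n → w ≡ + n → Rep 5 ν τ
    w-nonneg n w≡ = add-part ν τ s (subst (Rep 4 (ν - s * s)) (sym t≡)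
      (four-odd (ν - s * s) j n (trans u≡ (cong (λ z → (+ 2 * j + + 1) * (+ 2 * j + + 1) + (+ 3 + + 8 * z)) w≡))))
    -- If r = 5, then τ = 5 (s + 1), and D = 5 z.
    d≡5z : e ≡ + 2 → + d ≡ + 5 * (ν - + 5 * ((s + + 1) * (s + + 1)))
    d≡5z e≡2 = trans (sym D≡d) (trans (cong (λ t → + 5 * ν - t * t)
      (trans τ≡ (cong (λ e → + 5 * s + (+ 2 * e + + 1)) e≡2))) (lem ν s))
      where
      lem : ∀ ν s → + 5 * ν - (+ 5 * s + + 5) * (+ 5 * s + + 5) ≡ + 5 * (ν - + 5 * ((s + + 1) * (s + + 1)))
      lem = solve-∀
    multiple : e ≡ + 2 → ∀ n → w ≡ -[1+ n ] → ∀ z → ν - + 5 * ((s + + 1) * (s + + 1)) ≡ z → Rep 5 ν τ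
    multiple e≡2 n w≡ (+ 0) z≡ = x ∷ x ∷ x ∷ x ∷ x ∷ [] ,
      trans (lem₁′ s) (sym (trans τ≡ (cong (λ e → + 5 * s + (+ 2 * e + + 1)) e≡2))) ,
      trans (lem₂′ x) (sym (i-j≡0⇒i≡j ν _ z≡))
      where
      x : ℤ
      x = s + + 1
      lem₁′ : ∀ s → s + + 1 + (s + + 1 + (s + + 1 + (s + + 1 + (s + + 1 + + 0)))) ≡ + 5 * s + + 5
      lem₁′ = solve-∀
      lem₂′ : ∀ x → x * x + (x * x + (x * x + (x * x + (x * x + + 0)))) ≡ + 5 * (x * x)
      lem₂′ = solve-∀
    multiple e≡2 n w≡ (+ suc m) z≡ = ⊥-elim (contra (trans (d≡5z e≡2) (cong (+ 5 *_) z≡)) d≡0)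
      where
      25≡r² : + 25 ≡ r * r
      25≡r² = cong (λ e → (+ 2 * e + + 1) * (+ 2 * e + + 1)) (sym e≡2)
      d≡0 : d ≡ 0
      d≡0 = ℕₚ.n≤0⇒n≡0 (ℕₚ.≤-trans (ℕₚ.m≤n*m d 4) (ℕₚ.≤-trans (ℕₚ.m≤m+n (4 ℕ.* d) (40 ℕ.* n))
        (ℕₚ.≤-reflexive (sym (ℕₚ.+-cancelˡ-≡ 25 0 (4 ℕ.* d ℕ.+ 40 ℕ.* n)
          (+-injective (trans 25≡r² (w-negative n w≡))))))))
      contra : ∀ {m d} → + d ≡ + 5 * + suc m → d ≡ 0 → ⊥
      contra () refl
    multiple e≡2 n w≡ -[1+ m ] z≡ = ⊥-elim (contra (trans (d≡5z e≡2) (cong (+ 5 *_) z≡)))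
      where
      contra : ∀ {m d} → + d ≡ + 5 * -[1+ m ] → ⊥
      contra ()
    main : ∀ z → w ≡ z → Small r ⊎ e ≡ + 2 → Rep 5 ν τ
    main (+ n)    w≡ _                     = w-nonneg n w≡
    main -[1+ n ] w≡ (inj₁ (ρ , ρ≡ , ρ≤9)) = ⊥-elim (tiny ρ≤9 _ (trans (sym ρ≡) (w-negative n w≡)))
    main -[1+ n ] w≡ (inj₂ e≡2)            = multiple e≡2 n w≡ (ν - + 5 * ((s + + 1) * (s + + 1))) refl

  odd≢even : ∀ x y → + 4 * x ≢ + 4 * y + + 2
  odd≢even x y e = absurd (x - y) (trans (lem₁ x y) (trans (cong (λ z → z - + 4 * y) e) (lem₂ y)))
    where
    lem₁ : ∀ x y → + 4 * (x - y) ≡ + 4 * x - + 4 * y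
    lem₁ = solve-∀
    lem₂ : ∀ y → + 4 * y + + 2 - + 4 * y ≡ + 2
    lem₂ = solve-∀
    absurd : ∀ z → + 4 * z ≢ + 2
    absurd (+ 0) ()
    absurd (+ suc n) p with trans (sym (ℕₚ.*-suc 4 n)) (+-injective p)
    ... | ()
    absurd -[1+ n ] ()

  parity-step : ∀ ν τ k s → ν ≡ τ + + 2 * k → ∃ λ k′ → ν - s * s ≡ τ - s + + 2 * k′
  parity-step ν τ k s ν≡ with pronic s
  ... | h , e = k + s - h , (begin
    ν - s * s                           ≡⟨ cong (λ z → z - s * s) ν≡ ⟩
    τ + + 2 * k - s * s                 ≡⟨ lem₁ τ k s ⟩
    τ + + 2 * k - (s * s + s) + s       ≡⟨ cong (λ z → τ + + 2 * k - z + s) e ⟩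
    τ + + 2 * k - + 2 * h + s           ≡⟨ lem₂ τ k s h ⟩
    τ - s + + 2 * (k + s - h)           ∎)
    where
    open ≡-Reasoning
    lem₁ : ∀ τ k s → τ + + 2 * k - s * s ≡ τ + + 2 * k - (s * s + s) + s
    lem₁ = solve-∀
    lem₂ : ∀ τ k s h → τ + + 2 * k - + 2 * h + s ≡ τ - s + + 2 * (k + s - h)
    lem₂ = solve-∀

  -- With D = (m + 1) ν - τ² and r = τ - (m + 1) s, the new discriminant D′ satisfies (m + 1) D′ = m D - r².
  discriminant-step : ∀ m ν τ s r → τ ≡ (m + + 1) * s + r →
    r * r ≡ m * ((m + + 1) * ν - τ * τ) - (m + + 1) * (m * (ν - s * s) - (τ - s) * (τ - s))
  discriminant-step m ν _ s r refl = lem m ν s r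
    where
    lem : ∀ m ν s r → r * r ≡ m * ((m + + 1) * ν - ((m + + 1) * s + r) * ((m + + 1) * s + r))
      - (m + + 1) * (m * (ν - s * s) - ((m + + 1) * s + r - s) * ((m + + 1) * s + r - s))
    lem = solve-∀

  -- The discriminant D′ left for five numbers is even, so a negative one is at most -2. Then r² =
  -- 5D - 6D′ ≥ 12, against |r| ≤ 3.
  six : ∀ ν τ k → ν ≡ τ + + 2 * k → + 0 ≤ + 6 * ν - τ * τ → Rep 6 ν τ
  six ν τ k ν≡ 0≤D with nearest₆ τ | 0≤⇒+ 0≤D
  ... | s , r , τ≡ , ρ , ρ≡ , ρ≤9 | d , D≡d = main y refl
    where
    ν′ τ′ k′ h y : ℤ
    ν′ = ν - s * s
    τ′ = τ - s
    k′ = proj₁ (parity-step ν τ k s ν≡)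
    h = proj₁ (pronic τ′)
    y = + 5 * k′ + + 3 * τ′ - h
    D′≡ : + 5 * ν′ - τ′ * τ′ ≡ + 2 * y
    D′≡ = begin
      + 5 * ν′ - τ′ * τ′                                     ≡⟨ cong (λ z → + 5 * z - τ′ * τ′) (proj₂ (parity-step ν τ k s ν≡)) ⟩
      + 5 * (τ′ + + 2 * k′) - τ′ * τ′                        ≡⟨ lem₁ τ′ k′ ⟩
      + 10 * k′ + + 6 * τ′ - (τ′ * τ′ + τ′)                  ≡⟨ cong (λ z → + 10 * k′ + + 6 * τ′ - z) (proj₂ (pronic τ′)) ⟩
      + 10 * k′ + + 6 * τ′ - + 2 * h                         ≡⟨ lem₂ τ′ k′ h ⟩
      + 2 * y                                                ∎
      where
      open ≡-Reasoning
      lem₁ : ∀ τ k → + 5 * (τ + + 2 * k) - τ * τ ≡ + 10 * k + + 6 * τ - (τ * τ + τ)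
      lem₁ = solve-∀
      lem₂ : ∀ τ k h → + 10 * k + + 6 * τ - + 2 * h ≡ + 2 * (+ 5 * k + + 3 * τ - h)
      lem₂ = solve-∀
    main : ∀ z → y ≡ z → Rep 6 ν τ
    main (+ n) y≡ = add-part ν τ s (five ν′ τ′ k′ (proj₂ (parity-step ν τ k s ν≡))
      (subst (+ 0 ≤_) (sym (trans D′≡ (trans (cong (+ 2 *_) y≡) (sym (pos-* 2 n))))) (+≤+ z≤n)))
    main -[1+ n ] y≡ = ⊥-elim (tiny ρ≤9 _ (begin
      + ρ                                     ≡⟨ ρ≡ ⟨
      r * r                                   ≡⟨ discriminant-step (+ 5) ν τ s r τ≡ ⟩
      + 5 * (+ 6 * ν - τ * τ) - + 6 * (+ 5 * ν′ - τ′ * τ′)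
                                              ≡⟨ cong₂ (λ a b → + 5 * a - + 6 * b) D≡d (trans D′≡ (cong (+ 2 *_) y≡)) ⟩
      + 5 * + d - + 6 * (+ 2 * -[1+ n ])      ≡⟨ lem (+ d) (+ n) ⟩
      + 10 + (+ 2 + (+ 5 * + d + + 12 * + n)) ≡⟨ cong₂ (λ a b → + 10 + (+ 2 + (a + b))) (sym (pos-* 5 d)) (sym (pos-* 12 n)) ⟩
      + (10 ℕ.+ (2 ℕ.+ (5 ℕ.* d ℕ.+ 12 ℕ.* n))) ∎))
      where
      open ≡-Reasoning
      lem : ∀ d n → + 5 * d - + 6 * (+ 2 * (- (+ 1 + n))) ≡ + 10 + (+ 2 + (+ 5 * d + + 12 * n))
      lem = solve-∀

  -- From D′ ≤ -2 it would follow that r² = 6D - 7D′ ≥ 14, against |r| ≤ 3. Size alone does not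
  -- exclude D′ = -1, so a congruence does.
  seven : ∀ ν τ k → ν ≡ τ + + 2 * k → + 0 ≤ + 7 * ν - τ * τ → Rep 7 ν τ
  seven ν τ k ν≡ 0≤D with nearest₇ τ | 0≤⇒+ 0≤D
  ... | s , r , τ≡ , ρ , ρ≡ , ρ≤9 | d , D≡d = main (+ 6 * ν′ - τ′ * τ′) refl
    where
    ν′ τ′ k′ : ℤ
    ν′ = ν - s * s
    τ′ = τ - s
    k′ = proj₁ (parity-step ν τ k s ν≡)
    ν′≡ : ν′ ≡ τ′ + + 2 * k′
    ν′≡ = proj₂ (parity-step ν τ k s ν≡)
    main : ∀ z → + 6 * ν′ - τ′ * τ′ ≡ z → Rep 7 ν τ
    main (+ n) D′≡ = add-part ν τ s (six ν′ τ′ k′ ν′≡ (subst (+ 0 ≤_) (sym D′≡) (+≤+ z≤n)))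
    -- (τ′ - 3)² = 12 k′ + 10 is impossible modulo 4.
    main -[1+ 0 ] D′≡ = ⊥-elim (odd≢even (v * v) (+ 3 * k′ + + 2) (begin
      + 4 * (v * v)                                  ≡⟨ lem₁ v ⟩
      + 2 * v * (+ 2 * v)                            ≡⟨ cong (λ z → z * z) x≡2v ⟨
      x * x                                          ≡⟨ x²≡ ⟩
      + 4 * (+ 3 * k′ + + 2) + + 2                   ∎))
      where
      open ≡-Reasoning
      x h v : ℤ
      x = τ′ - + 3
      h = proj₁ (pronic x)
      v = h - + 6 * k′ - + 5
      lem₁ : ∀ v → + 4 * (v * v) ≡ + 2 * v * (+ 2 * v)
      lem₁ = solve-∀
      lem₂ : ∀ τ k → (τ - + 3) * (τ - + 3) ≡ + 4 * (+ 3 * k + + 2) + + 1 - (+ 6 * (τ + + 2 * k) - τ * τ)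
      lem₂ = solve-∀
      lem₃ : ∀ k → + 4 * (+ 3 * k + + 2) + + 1 - -[1+ 0 ] ≡ + 4 * (+ 3 * k + + 2) + + 2
      lem₃ = solve-∀
      x²≡ : x * x ≡ + 4 * (+ 3 * k′ + + 2) + + 2
      x²≡ = trans (lem₂ τ′ k′) (trans (cong (λ z → + 4 * (+ 3 * k′ + + 2) + + 1 - z)
        (trans (cong (λ z → + 6 * z - τ′ * τ′) (sym ν′≡)) D′≡)) (lem₃ k′))
      lem₄ : ∀ x → x ≡ x * x + x - x * x
      lem₄ = solve-∀
      lem₅ : ∀ h k → + 2 * h - (+ 4 * (+ 3 * k + + 2) + + 2) ≡ + 2 * (h - + 6 * k - + 5)
      lem₅ = solve-∀
      x≡2v : x ≡ + 2 * v
      x≡2v = trans (lem₄ x) (trans (cong₂ _-_ (proj₂ (pronic x)) x²≡) (lem₅ h k′))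
    main -[1+ suc n ] D′≡ = ⊥-elim (tiny ρ≤9 _ (begin
      + ρ                                     ≡⟨ ρ≡ ⟨
      r * r                                   ≡⟨ discriminant-step (+ 6) ν τ s r τ≡ ⟩
      + 6 * (+ 7 * ν - τ * τ) - + 7 * (+ 6 * ν′ - τ′ * τ′)
                                              ≡⟨ cong₂ (λ a b → + 6 * a - + 7 * b) D≡d D′≡ ⟩
      + 6 * + d - + 7 * -[1+ suc n ]          ≡⟨ lem (+ d) (+ n) ⟩
      + 10 + (+ 4 + (+ 6 * + d + + 7 * + n))  ≡⟨ cong₂ (λ a b → + 10 + (+ 4 + (a + b))) (sym (pos-* 6 d)) (sym (pos-* 7 n)) ⟩
      + (10 ℕ.+ (4 ℕ.+ (6 ℕ.* d ℕ.+ 7 ℕ.* n))) ∎))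
      where
      open ≡-Reasoning
      lem : ∀ d n → + 6 * d - + 7 * (- (+ 2 + n)) ≡ + 10 + (+ 4 + (+ 6 * d + + 7 * n))
      lem = solve-∀

  module _ (m n : ℕ) (T : ℤ) where

    necessary : 𝒮 m n T → SameParity n T × + 0 ≤ + (m ℕ.* n) - T * T
    necessary (v , refl , e) with parity v
    ... | k , p =
      ∣⇒∣ᵤ {+ 2} (divides k (trans (cong (λ z → z - sumℤ v) (trans (sym e) p)) (lem (sumℤ v) k))) ,
      subst (λ z → + 0 ≤ z - sumℤ v * sumℤ v) (trans (cong (+ m *_) e) (sym (pos-* m n))) (cauchy-schwarz v)
      where
      lem : ∀ s k → s + + 2 * k - s ≡ k * + 2
      lem = solve-∀

    sufficient : (∀ ν τ k → ν ≡ τ + + 2 * k → + 0 ≤ + m * ν - τ * τ → Rep m ν τ) →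
      SameParity n T × + 0 ≤ + (m ℕ.* n) - T * T → 𝒮 m n T
    sufficient rep (2∣ , 0≤D) with ∣ᵤ⇒∣ {+ 2} {+ n - T} 2∣
    ... | divides k e = rep (+ n) T k (trans (lem₁ (+ n) T) (trans (cong (λ z → T + z) e) (lem₂ T k)))
      (subst (λ z → + 0 ≤ z - T * T) (pos-* m n) 0≤D)
      where
      lem₁ : ∀ n t → n ≡ t + (n - t)
      lem₁ = solve-∀
      lem₂ : ∀ t k → t + k * + 2 ≡ t + + 2 * k
      lem₂ = solve-∀

  full : ∀ m n → (∀ T → 𝒮 m n T ⇔ (SameParity n T × + 0 ≤ + (m ℕ.* n) - T * T)) → Full m n
  full m n char T = mk⇔
    (λ { (rep , T²<) → proj₁ (Equivalence.to (char T) rep) , T²< })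
    (λ { (2∣ , T²<) → Equivalence.from (char T) (2∣ , i≤j⇒0≤j-i (<⇒≤ T²<)) , T²< })

  large-rank : ∀ m → 5 ℕ.≤ m → m ℕ.≤ 7 → ∀ ν τ k → ν ≡ τ + + 2 * k → + 0 ≤ + m * ν - τ * τ → Rep m ν τ
  large-rank 1 (s≤s ())
  large-rank 2 (s≤s (s≤s ()))
  large-rank 3 (s≤s (s≤s (s≤s ())))
  large-rank 4 (s≤s (s≤s (s≤s (s≤s ()))))
  large-rank 5 _ _ = five
  large-rank 6 _ _ = six
  large-rank 7 _ _ = seven
  large-rank (suc (suc (suc (suc (suc (suc (suc (suc _)))))))) _ (s≤s (s≤s (s≤s (s≤s (s≤s (s≤s (s≤s ())))))))

  part-iv : ∀ n T m → 5 ℕ.≤ m → m ℕ.≤ 7 →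
    (𝒮 m n T ⇔ (SameParity n T × + 0 ≤ + (m ℕ.* n) - T * T)) × Full m n
  part-iv n T m 5≤m m≤7 = char T , full m n char
    where
    char : ∀ T → 𝒮 m n T ⇔ (SameParity n T × + 0 ≤ + (m ℕ.* n) - T * T)
    char T = mk⇔ (necessary m n T) (sufficient m n T (large-rank m 5≤m m≤7))

-- Reduction of binary forms of discriminant -3 to the norm form.

module NormForm where

  open import Data.Empty using (⊥-elim)
  open import Data.Nat.Base as ℕ using (ℕ; zero; suc; s≤s; z≤n)
  import Data.Nat.Properties as ℕₚ
  open import Data.Nat.Induction using (<-rec)
  import Data.Nat.Tactic.RingSolver as ℕ-Solver
  open import Data.Integer.Base hiding (suc; pred)
  open import Data.Integer.Properties
  open import Data.Integer.DivMod using (_%ℕ_; _/ℕ_; n%ℕd<d; a≡a%ℕn+[a/ℕn]*n)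
  open import Data.Integer.Tactic.RingSolver using (solve-∀)
  open import Data.Product using (∃; _×_; _,_)
  open import Relation.Binary.PropositionalEquality
  open import Relation.Nullary using (yes; no)

  -- The norm form of the Eisenstein integers.
  N : ℤ → ℤ → ℤ
  N a b = a * a + a * b + b * b

  Loeschian : ℕ → Set
  Loeschian n = ∃ λ a → ∃ λ b → + n ≡ N a b

  -- A factorisation of the form a X² + (2b + 1) X Y + c Y², of discriminant -3, through N.
  Reduced : ℤ → ℤ → ℤ → Set
  Reduced a b c = ∃ λ u → ∃ λ v → ∃ λ s → ∃ λ t →
    a ≡ N u v × c ≡ N s t × + 2 * b + + 1 ≡ + 2 * (u * s) + u * t + v * s + + 2 * (v * t)

  -- The substitution (X, Y) ↦ (-Y, X).
  reduced-swap : ∀ a b c → Reduced c (- b - + 1) a → Reduced a b c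
  reduced-swap a b c (u , v , s , t , p , q , r) = s , t , - u , - v , q ,
    trans p (lem₁ u v) , trans (lem₂ b) (trans (cong -_ r) (lem₃ u v s t))
    where
    lem₁ : ∀ u v → u * u + u * v + v * v ≡ - u * - u + - u * - v + - v * - v
    lem₁ = solve-∀
    lem₂ : ∀ b → + 2 * b + + 1 ≡ - (+ 2 * (- b - + 1) + + 1)
    lem₂ = solve-∀
    lem₃ : ∀ u v s t → - (+ 2 * (u * s) + u * t + v * s + + 2 * (v * t))
                     ≡ + 2 * (s * - u) + s * - v + t * - u + + 2 * (t * - v)
    lem₃ = solve-∀

  -- The substitution X ↦ X + kY.
  reduced-shift : ∀ a b c k → Reduced a b c → Reduced a (b + k * a) (c + k * (+ 2 * b + + 1) + k * k * a)
  reduced-shift a b c k (u , v , s , t , p , q , r) = u , v , s + k * u , t + k * v , p ,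
    trans (cong₂ (λ x y → x + k * y + k * k * a) q r)
          (trans (cong (λ z → N s t + k * X + k * k * z) p) (lem₁ u v s t k)) ,
    trans (lem₂ a b k) (trans (cong₂ (λ x y → x + + 2 * k * y) r p) (lem₃ u v s t k))
    where
    X : ℤ
    X = + 2 * (u * s) + u * t + v * s + + 2 * (v * t)
    lem₁ : ∀ u v s t k → (s * s + s * t + t * t) + k * (+ 2 * (u * s) + u * t + v * s + + 2 * (v * t)) + k * k * (u * u + u * v + v * v)
      ≡ (s + k * u) * (s + k * u) + (s + k * u) * (t + k * v) + (t + k * v) * (t + k * v)
    lem₁ = solve-∀
    lem₂ : ∀ a b k → + 2 * (b + k * a) + + 1 ≡ (+ 2 * b + + 1) + + 2 * k * a
    lem₂ = solve-∀
    lem₃ : ∀ u v s t k → (+ 2 * (u * s) + u * t + v * s + + 2 * (v * t)) + + 2 * k * (u * u + u * v + v * v)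
      ≡ + 2 * (u * (s + k * u)) + u * (t + k * v) + v * (s + k * u) + + 2 * (v * (t + k * v))
    lem₃ = solve-∀

  -- The representative b′ is ρ or -ρ - 1, so |2b′ + 1| = 2ρ + 1 ≤ a, the usual reduction condition
  -- on the middle coefficient. Both choices give b′² + b′ + 1 the same value.
  centred : ∀ a b → .{{_ : ℕ.NonZero a}} → ∃ λ ρ → ∃ λ b′ → ∃ λ k →
    2 ℕ.* ρ ℕ.+ 1 ℕ.≤ a × b ≡ b′ + k * + a × b′ * b′ + b′ + + 1 ≡ + (ρ ℕ.* ρ ℕ.+ ρ ℕ.+ 1)
  centred a b = go (2 ℕ.* r ℕ.+ 1 ℕₚ.≤? a)
    where
    r : ℕ
    r = b %ℕ a
    k : ℤ
    k = b /ℕ a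
    b≡ : b ≡ + r + k * + a
    b≡ = a≡a%ℕn+[a/ℕn]*n b a
    pos-form : ∀ ρ → + ρ * + ρ + + ρ + + 1 ≡ + (ρ ℕ.* ρ ℕ.+ ρ ℕ.+ 1)
    pos-form ρ = cong (λ z → z + + ρ + + 1) (sym (pos-* ρ ρ))
    go : _ → _
    go (yes p) = r , + r , k , p , b≡ , pos-form r
    go (no ¬p) = m , - + m - + 1 , k + + 1 , m-small ,
      trans b≡ (trans (lem₁ (+ r) k (+ a)) (cong (λ z → z + (k + + 1) * + a) (trans (cong (λ z → + r - z) a≡) (lem₂ (+ r) (+ m))))) ,
      trans (lem₃ (+ m)) (pos-form m)
      where
      m : ℕ
      m = a ℕ.∸ suc r
      r<a : suc r ℕ.≤ a
      r<a = n%ℕd<d b a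
      a≡ℕ : a ≡ suc r ℕ.+ m
      a≡ℕ = sym (ℕₚ.m+[n∸m]≡n r<a)
      a≡ : + a ≡ + r + + 1 + + m
      a≡ = cong +_ (trans a≡ℕ (cong (ℕ._+ m) (ℕₚ.+-comm 1 r)))
      m-small : 2 ℕ.* m ℕ.+ 1 ℕ.≤ a
      m-small = ℕₚ.+-cancelʳ-≤ (2 ℕ.* r) _ _ (begin
        2 ℕ.* m ℕ.+ 1 ℕ.+ 2 ℕ.* r                    ≤⟨ ℕₚ.n≤1+n _ ⟩
        suc (2 ℕ.* m ℕ.+ 1 ℕ.+ 2 ℕ.* r)              ≡⟨ lem m r ⟩
        2 ℕ.* (suc r ℕ.+ m)                          ≡⟨ cong (2 ℕ.*_) a≡ℕ ⟨
        2 ℕ.* a                                      ≡⟨ cong (a ℕ.+_) (ℕₚ.+-identityʳ a) ⟩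
        a ℕ.+ a                                      ≤⟨ ℕₚ.+-monoʳ-≤ a a≤2r ⟩
        a ℕ.+ 2 ℕ.* r                                ∎)
        where
        open ℕₚ.≤-Reasoning
        a≤2r : a ℕ.≤ 2 ℕ.* r
        a≤2r = ℕ.s≤s⁻¹ (subst (a ℕ.<_) (ℕₚ.+-comm (2 ℕ.* r) 1) (ℕₚ.≰⇒> ¬p))
        lem : ∀ m r → 1 ℕ.+ (2 ℕ.* m ℕ.+ 1 ℕ.+ 2 ℕ.* r) ≡ 2 ℕ.* (1 ℕ.+ r ℕ.+ m)
        lem = ℕ-Solver.solve-∀
      lem₁ : ∀ r k a → r + k * a ≡ (r - a) + (k + + 1) * a
      lem₁ = solve-∀
      lem₂ : ∀ r m → r - (r + + 1 + m) ≡ - m - + 1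
      lem₂ = solve-∀
      lem₃ : ∀ m → (- m - + 1) * (- m - + 1) + (- m - + 1) + + 1 ≡ m * m + m + + 1
      lem₃ = solve-∀

  -- Gauss reduction: once b is centred, c = (b² + b + 1) / a lies strictly between 0 and a when a ≥
  -- 2, and swapping makes it the first coefficient. For a = 1 the form is `N` at (X + bY, Y).
  reduce : ∀ a b c → + suc a * c ≡ b * b + b + + 1 → Reduced (+ suc a) b c
  reduce = <-rec _ step
    where
    step : ∀ a → (∀ {a′} → a′ ℕ.< a → ∀ b c → + suc a′ * c ≡ b * b + b + + 1 → Reduced (+ suc a′) b c) →
           ∀ b c → + suc a * c ≡ b * b + b + + 1 → Reduced (+ suc a) b c
    step zero rec b c e = + 1 , + 0 , b , + 1 , refl , trans (sym (*-identityˡ c)) (trans e (lem₁ b)) , lem₂ b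
      where
      lem₁ : ∀ b → b * b + b + + 1 ≡ b * b + b * + 1 + + 1 * + 1
      lem₁ = solve-∀
      lem₂ : ∀ b → + 2 * b + + 1 ≡ + 2 * (+ 1 * b) + + 1 * + 1 + + 0 * b + + 2 * (+ 0 * + 1)
      lem₂ = solve-∀
    step (suc a₀) rec b c e with centred (suc (suc a₀)) b
    ... | ρ , b′ , k , small , b≡ , norm≡ = subst₂ (Reduced (+ a)) (sym b≡) c≡ (reduced-shift (+ a) b′ c′ k (main c′ refl))
      where
      a : ℕ
      a = suc (suc a₀)
      c′ : ℤ
      c′ = c - k * (+ 2 * b′ + + 1) - k * k * + a
      c≡ : c′ + k * (+ 2 * b′ + + 1) + k * k * + a ≡ c
      c≡ = lem c (k * (+ 2 * b′ + + 1)) (k * k * + a)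
        where
        lem : ∀ c x y → c - x - y + x + y ≡ c
        lem = solve-∀
      ac′ : + a * c′ ≡ b′ * b′ + b′ + + 1
      ac′ = trans (lem₁ (+ a) c k b′) (trans (cong (λ z → z - k * + a * (+ 2 * b′ + + 1) - k * k * + a * + a)
              (trans e (cong (λ z → z * z + z + + 1) b≡))) (lem₂ (+ a) k b′))
        where
        lem₁ : ∀ a c k b → a * (c - k * (+ 2 * b + + 1) - k * k * a) ≡ a * c - k * a * (+ 2 * b + + 1) - k * k * a * a
        lem₁ = solve-∀
        lem₂ : ∀ a k b → (b + k * a) * (b + k * a) + (b + k * a) + + 1 - k * a * (+ 2 * b + + 1) - k * k * a * a ≡ b * b + b + + 1
        lem₂ = solve-∀
      ac′≡ρ : + a * c′ ≡ + (ρ ℕ.* ρ ℕ.+ ρ ℕ.+ 1)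
      ac′≡ρ = trans ac′ norm≡
      ρ<a² : ρ ℕ.* ρ ℕ.+ ρ ℕ.+ 1 ℕ.< a ℕ.* a
      ρ<a² = ρ-bound ρ small
        where
        ρ-bound : ∀ ρ → 2 ℕ.* ρ ℕ.+ 1 ℕ.≤ a → ρ ℕ.* ρ ℕ.+ ρ ℕ.+ 1 ℕ.< a ℕ.* a
        ρ-bound zero    _ = s≤s (s≤s z≤n)
        ρ-bound (suc ρ) p = ℕₚ.<-≤-trans
          (ℕₚ.≤-trans (ℕₚ.m≤m+n _ (3 ℕ.* (ρ ℕ.* ρ) ℕ.+ 9 ℕ.* ρ ℕ.+ 5)) (ℕₚ.≤-reflexive (lem ρ))) (ℕₚ.*-mono-≤ p p)
          where
          lem : ∀ ρ → 1 ℕ.+ ((1 ℕ.+ ρ) ℕ.* (1 ℕ.+ ρ) ℕ.+ (1 ℕ.+ ρ) ℕ.+ 1) ℕ.+ (3 ℕ.* (ρ ℕ.* ρ) ℕ.+ 9 ℕ.* ρ ℕ.+ 5)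
                    ≡ (2 ℕ.* (1 ℕ.+ ρ) ℕ.+ 1) ℕ.* (2 ℕ.* (1 ℕ.+ ρ) ℕ.+ 1)
          lem = ℕ-Solver.solve-∀
      main : ∀ z → c′ ≡ z → Reduced (+ a) b′ c′
      main (+ zero) c′≡ = ⊥-elim (absurd (trans (sym (*-zeroʳ (+ a))) (trans (cong (λ z → + a * z) (sym c′≡)) ac′≡ρ)))
        where
        absurd : + 0 ≢ + (ρ ℕ.* ρ ℕ.+ ρ ℕ.+ 1)
        absurd p = ℕₚ.1+n≢0 (trans (ℕₚ.+-comm 1 _) (sym (+-injective p)))
      main (+ suc n) c′≡ = subst (Reduced (+ a) b′) (sym c′≡) (reduced-swap (+ a) b′ (+ suc n) (rec n<a (- b′ - + 1) (+ a)
        (trans (*-comm (+ suc n) (+ a)) (trans (cong (λ z → + a * z) (sym c′≡)) (trans ac′ (lem b′))))))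
        where
        lem : ∀ b → b * b + b + + 1 ≡ (- b - + 1) * (- b - + 1) + (- b - + 1) + + 1
        lem = solve-∀
        n<a : suc n ℕ.≤ suc a₀
        n<a = ℕ.s≤s⁻¹ (ℕₚ.*-cancelˡ-< a (suc n) a (subst (ℕ._< a ℕ.* a)
          (+-injective (trans (sym ac′≡ρ) (trans (cong (λ z → + a * z) c′≡) (sym (pos-* a (suc n)))))) ρ<a²))
      main -[1+ n ] c′≡ = ⊥-elim (absurd (trans (cong (λ z → + a * z) (sym c′≡)) ac′≡ρ))
        where
        absurd : + a * -[1+ n ] ≢ + (ρ ℕ.* ρ ℕ.+ ρ ℕ.+ 1)
        absurd ()

  -- A divisor of b² + b + 1 is the first coefficient of such a form, hence the value of `N` at the
  -- image of (1, 0).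
  divisor-loeschian : ∀ a b c → + suc a * c ≡ b * b + b + + 1 → Loeschian (suc a)
  divisor-loeschian a b c e with reduce a b c e
  ... | u , v , _ , _ , p , _ = u , v , p

  -- `N a b` is the norm of a - bω for a primitive cube root of unity ω; the witnesses are the
  -- coordinates of (a - bω)(c - dω).
  loeschian-* : ∀ m n → Loeschian m → Loeschian n → Loeschian (m ℕ.* n)
  loeschian-* m n (a , b , p) (c , d , q) = a * c - b * d , a * d + b * c + b * d ,
    trans (pos-* m n) (trans (cong₂ _*_ p q) (lem a b c d))
    where
    lem : ∀ a b c d → (a * a + a * b + b * b) * (c * c + c * d + d * d)
        ≡ (a * c - b * d) * (a * c - b * d) + (a * c - b * d) * (a * d + b * c + b * d)
          + (a * d + b * c + b * d) * (a * d + b * c + b * d)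
    lem = solve-∀

  loeschian-square : ∀ n → Loeschian (n ℕ.* n)
  loeschian-square n = + n , + 0 , trans (pos-* n n) (lem (+ n))
    where
    lem : ∀ n → n * n ≡ n * n + n * + 0 + + 0 * + 0
    lem = solve-∀

-- Primes p ≡ 1 mod 3 are norms.

module SplitPrimes where

  open NormForm using (Loeschian; divisor-loeschian)
  open import Data.Empty using (⊥-elim)
  open import Data.Fin.Base using (Fin; toℕ; fromℕ<)
  open import Data.Fin.Permutation using (permutation)
  open import Data.Fin.Properties using (toℕ<n; toℕ-injective; toℕ-fromℕ<; any?; _≟_)
  import Data.Integer.Base as ℤ
  import Data.Integer.Divisibility.Signed as ℤD
  import Data.Integer.Properties as ℤₚ
  import Data.Integer.Tactic.RingSolver as ℤ-Solver
  open import Data.Nat.Base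
  open import Data.Nat.Coprimality using (prime⇒coprime; coprime-Bézout)
  open import Data.Nat.Divisibility
  open import Data.Nat.DivMod
  open import Data.Nat.GCD using (module Bézout)
  open import Data.Nat.Primality using (Prime; ¬prime[1])
  open import Data.Nat.Properties hiding (_≟_)
  open import Algebra.Properties.CommutativeMonoid.Sum +-0-commutativeMonoid using (sum; sum-cong-≗; ∑-distrib-+; ∑-permute)
  open import Data.Nat.Tactic.RingSolver using (solve-∀)
  open import Data.Product using (∃; _×_; _,_; proj₁; proj₂)
  open import Data.Sum using (_⊎_; inj₁; inj₂)
  open import Relation.Binary.Definitions using (tri<; tri≈; tri>)
  open import Relation.Binary.PropositionalEquality
  open import Relation.Nullary using (Dec; ¬_; yes; no)

  least : ℕ → ℕ → ℕ → ℕ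
  least a b c with a <? b | a <? c
  ... | yes _ | yes _ = 1
  ... | yes _ | no _  = 0
  ... | no _  | _     = 0

  least-1 : ∀ {a b c} → a < b → a < c → least a b c ≡ 1
  least-1 {a} {b} {c} a<b a<c with a <? b | a <? c
  ... | yes _  | yes _  = refl
  ... | yes _  | no a≮c = ⊥-elim (a≮c a<c)
  ... | no a≮b | _      = ⊥-elim (a≮b a<b)

  least-0ˡ : ∀ {a b} c → b < a → least a b c ≡ 0
  least-0ˡ {a} {b} c b<a with a <? b | a <? c
  ... | yes a<b | _ = ⊥-elim (<-asym a<b b<a)
  ... | no _    | _ = refl

  least-0ʳ : ∀ {a c} b → c < a → least a b c ≡ 0
  least-0ʳ {a} {c} b c<a with a <? b | a <? c
  ... | yes _ | yes a<c = ⊥-elim (<-asym a<c c<a)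
  ... | yes _ | no _    = refl
  ... | no _  | _       = refl

  least-cyclic : ∀ {a b c} → a ≢ b → b ≢ c → c ≢ a → least a b c + least b c a + least c a b ≡ 1
  least-cyclic {a} {b} {c} a≢b b≢c c≢a with <-cmp a b | <-cmp b c | <-cmp c a
  ... | tri≈ _ e _ | _ | _ = ⊥-elim (a≢b e)
  ... | _ | tri≈ _ e _ | _ = ⊥-elim (b≢c e)
  ... | _ | _ | tri≈ _ e _ = ⊥-elim (c≢a e)
  ... | tri< a<b _ _ | _ | tri> _ _ a<c = cong₂ _+_ (cong₂ _+_ (least-1 a<b a<c) (least-0ʳ c a<b)) (least-0ˡ b a<c)
  ... | tri> _ _ b<a | tri< b<c _ _ | _ = cong₂ _+_ (cong₂ _+_ (least-0ˡ c b<a) (least-1 b<c b<a)) (least-0ʳ a b<c)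
  ... | _ | tri> _ _ c<b | tri< c<a _ _ = cong₂ _+_ (cong₂ _+_ (least-0ʳ b c<a) (least-0ˡ a c<b)) (least-1 c<a c<b)
  ... | tri< a<b _ _ | tri< b<c _ _ | tri< c<a _ _ = ⊥-elim (<-asym (<-trans a<b b<c) c<a)
  ... | tri> _ _ b<a | tri> _ _ c<b | tri> _ _ a<c = ⊥-elim (<-asym (<-trans c<b b<a) a<c)

  -- In each orbit of a fixed-point-free map of order three exactly one element is least.
  order-three : ∀ {m} (f : Fin m → Fin m) → (∀ i → f (f (f i)) ≡ i) → (∀ i → f i ≢ i) → 3 ∣ m
  order-three {m} f fff≡id f≢id = divides (sum A) (begin
    m                                                   ≡⟨ sum-1 m ⟨
    sum {m} (λ _ → 1)                                   ≡⟨ sum-cong-≗ (λ i → sym (one i)) ⟩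
    sum (λ i → A i + A (f i) + A (f (f i)))             ≡⟨ ∑-distrib-+ (λ i → A i + A (f i)) (λ i → A (f (f i))) ⟩
    sum (λ i → A i + A (f i)) + sum (λ i → A (f (f i))) ≡⟨ cong (_+ sum (λ i → A (f (f i)))) (∑-distrib-+ A (λ i → A (f i))) ⟩
    sum A + sum (λ i → A (f i)) + sum (λ i → A (f (f i)))
      ≡⟨ cong₂ (λ x y → sum A + x + y)
           (∑-permute A (permutation f (λ i → f (f i)) fff≡id fff≡id))
           (∑-permute A (permutation (λ i → f (f i)) f fff≡id fff≡id)) ⟨
    sum A + sum A + sum A                               ≡⟨ triple (sum A) ⟩
    sum A * 3                                           ∎)
    where
    open ≡-Reasoning
    A : Fin m → ℕ
    A i = least (toℕ i) (toℕ (f i)) (toℕ (f (f i)))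
    sum-1 : ∀ m → sum {m} (λ _ → 1) ≡ m
    sum-1 zero    = refl
    sum-1 (suc m) = cong suc (sum-1 m)
    triple : ∀ x → x + x + x ≡ x * 3
    triple = solve-∀
    one : ∀ i → A i + A (f i) + A (f (f i)) ≡ 1
    one i = trans (cong₂ (λ x y → A i + least (toℕ (f i)) (toℕ (f (f i))) (toℕ x) + least (toℕ (f (f i))) (toℕ x) (toℕ y))
                    (fff≡id i) (cong f (fff≡id i)))
      (least-cyclic (λ e → f≢id i (sym (toℕ-injective e)))
                    (λ e → f≢id (f i) (sym (toℕ-injective e)))
                    (λ e → f≢id (f (f i)) (trans (fff≡id i) (sym (toℕ-injective e)))))

  module _ (m : ℕ) (p-prime : Prime (2 + m)) where

    p : ℕ
    p = 2 + m

    -- The relation y = 1 / (1 - x) modulo p between x = 2 + i and y = 2 + j.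
    _↝_ : ℕ → ℕ → Set
    i ↝ j = p ∣ suc i * (2 + j) + 1

    minus-inverse : ∀ i → i < suc m → ∃ λ v → p ∣ suc i * v + 1
    minus-inverse i i<1+m = from (coprime-Bézout (prime⇒coprime {n = suc i} p-prime (s<s i<1+m)))
      where
      lem₀ : ∀ i v → i * v + 1 ≡ 1 + v * i
      lem₀ = solve-∀
      lem₁ : ∀ i v m → i * ((1 + m) * v) + 1 ≡ (1 + m) * (v * i) + 1
      lem₁ = solve-∀
      lem₂ : ∀ u m → (1 + m) * (1 + u * (2 + m)) + 1 ≡ (1 + (1 + m) * u) * (2 + m)
      lem₂ = solve-∀
      from : Bézout.Identity 1 p (suc i) → ∃ λ v → p ∣ suc i * v + 1
      from (Bézout.+- u v e) = v , divides u (trans (lem₀ (suc i) v) e)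
      -- Here v is the inverse itself; the factor `suc m` = p - 1 is -1 modulo p.
      from (Bézout.-+ u v e) = suc m * v , divides (1 + suc m * u) (trans (lem₁ (suc i) v m)
        (trans (cong (λ z → suc m * z + 1) (sym e)) (lem₂ u m)))

    rotate : ∀ i → i < m → ∃ λ j → j < m × i ↝ j
    rotate i i<m = go y refl (m%n<n v p) p∣y
      where
      v y : ℕ
      v = proj₁ (minus-inverse i (m<n⇒m<1+n i<m))
      y = v % p
      p∣y : p ∣ suc i * y + 1
      p∣y = ∣m+n∣m⇒∣n (subst (p ∣_) (trans (cong (λ z → suc i * z + 1) (m≡m%n+[m/n]*n v p)) (lem i y (v / p) p))
                        (proj₂ (minus-inverse i (m<n⇒m<1+n i<m))))
                      (n∣m*n (suc i * (v / p)))
        where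
        lem : ∀ i y q p → (1 + i) * (y + q * p) + 1 ≡ (1 + i) * q * p + ((1 + i) * y + 1)
        lem = solve-∀
      go : ∀ z → y ≡ z → z < p → p ∣ suc i * z + 1 → ∃ λ j → j < m × i ↝ j
      -- The value 0 is not invertible, and 1 / (1 - x) = 1 would need x = 0; so the residues 2,
      -- ..., p - 1 are mapped to themselves.
      go zero _ _ p∣z = ⊥-elim (1+n≰n (≤-trans (s≤s (s≤s (z≤n {m}))) (∣⇒≤ {n = 1} (subst (λ w → p ∣ w + 1) (*-zeroʳ (suc i)) p∣z))))
      go (suc zero) _ _ p∣z = ⊥-elim (<-irrefl refl (<-≤-trans (s<s (s<s i<m)) (∣⇒≤ (subst (p ∣_) (lem i) p∣z))))
        where
        lem : ∀ i → (1 + i) * 1 + 1 ≡ 2 + i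
        lem = solve-∀
      go (suc (suc j)) _ (s<s (s<s j<m)) p∣z = j , j<m , p∣z

    ∣-differ : ∀ {a b} → a < p → a ≤ b → b < p → (ℤ.+ p) ℤD.∣ (ℤ.+ b ℤ.- ℤ.+ a) → a ≡ b
    ∣-differ {a} {b} a<p a≤b b<p p∣ = sym (≤-antisym (m∸n≡0⇒m≤n (zero-of (b ∸ a) (≤-<-trans (m∸n≤m b a) b<p) p∣ᵤ)) a≤b)
      where
      p∣ᵤ : p ∣ b ∸ a
      p∣ᵤ = subst (λ z → p ∣ ℤ.∣ z ∣) (trans (ℤₚ.m-n≡m⊖n b a) (ℤₚ.⊖-≥ a≤b)) (ℤD.∣⇒∣ᵤ p∣)
      zero-of : ∀ d → d < p → p ∣ d → d ≡ 0
      zero-of zero    _   _   = refl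
      zero-of (suc d) d<p p∣d = ⊥-elim (<-irrefl refl (<-≤-trans d<p (∣⇒≤ p∣d)))

    ↝-cycle : ∀ i j k l → i < m → l < m → i ↝ j → j ↝ k → k ↝ l → l ≡ i
    ↝-cycle i j k l i<m l<m i↝j j↝k k↝l = ordered (≤-total i l)
      where
      bound : ∀ {i} → i < m → i < p
      bound i<m = ≤-trans i<m (≤-trans (n≤1+n m) (n≤1+n (suc m)))
      relation : ∀ i j → i ↝ j → (ℤ.+ p) ℤD.∣ ((ℤ.+ 1 ℤ.+ ℤ.+ i) ℤ.* (ℤ.+ 2 ℤ.+ ℤ.+ j) ℤ.+ ℤ.+ 1)
      relation i j d = subst (ℤ.+ p ℤD.∣_) (cong (λ z → z ℤ.+ ℤ.+ 1) (ℤₚ.pos-* (suc i) (2 + j))) (ℤD.∣ᵤ⇒∣ d)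
      -- The inner combination eliminates j and leaves (2 + i)(1 + k) + 1; the outer one eliminates
      -- k.
      difference : (ℤ.+ p) ℤD.∣ (ℤ.+ l ℤ.- ℤ.+ i)
      difference = subst (ℤ.+ p ℤD.∣_) (sym (identity (ℤ.+ i) (ℤ.+ j) (ℤ.+ k) (ℤ.+ l)))
        (ℤD.∣m∣n⇒∣m-n (ℤD.∣n⇒∣m*n (ℤ.+ 2 ℤ.+ ℤ.+ l) (ℤD.∣m∣n⇒∣m-n
            (ℤD.∣n⇒∣m*n (ℤ.+ 2 ℤ.+ ℤ.+ k) (relation i j i↝j))
            (ℤD.∣n⇒∣m*n (ℤ.+ 1 ℤ.+ ℤ.+ i) (relation j k j↝k))))
          (ℤD.∣n⇒∣m*n (ℤ.+ 2 ℤ.+ ℤ.+ i) (relation k l k↝l)))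
        where
        open ℤ using () renaming (_+_ to _⊕_; _*_ to _⊗_; _-_ to _⊖_; +_ to pos)
        identity : ∀ i j k l → l ⊖ i ≡
          (pos 2 ⊕ l) ⊗ ((pos 2 ⊕ k) ⊗ ((pos 1 ⊕ i) ⊗ (pos 2 ⊕ j) ⊕ pos 1)
                          ⊖ (pos 1 ⊕ i) ⊗ ((pos 1 ⊕ j) ⊗ (pos 2 ⊕ k) ⊕ pos 1))
          ⊖ (pos 2 ⊕ i) ⊗ ((pos 1 ⊕ k) ⊗ (pos 2 ⊕ l) ⊕ pos 1)
        identity = ℤ-Solver.solve-∀
      neg-swap : ∀ a b → ℤ.- (a ℤ.- b) ≡ b ℤ.- a
      neg-swap = ℤ-Solver.solve-∀
      ordered : i ≤ l ⊎ l ≤ i → l ≡ i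
      ordered (inj₁ i≤l) = sym (∣-differ (bound i<m) i≤l (bound l<m) difference)
      ordered (inj₂ l≤i) = ∣-differ (bound l<m) l≤i (bound i<m)
        (subst (ℤ.+ p ℤD.∣_) (neg-swap (ℤ.+ l) (ℤ.+ i)) (ℤD.∣m⇒∣-m difference))

    f : Fin m → Fin m
    f i = fromℕ< (proj₁ (proj₂ (rotate (toℕ i) (toℕ<n i))))

    f-spec : ∀ i → toℕ i ↝ toℕ (f i)
    f-spec i = subst (toℕ i ↝_) (sym (toℕ-fromℕ< (proj₁ (proj₂ (rotate (toℕ i) (toℕ<n i))))))
      (proj₂ (proj₂ (rotate (toℕ i) (toℕ<n i))))

    f-cycle : ∀ i → f (f (f i)) ≡ i
    f-cycle i = toℕ-injective (↝-cycle (toℕ i) (toℕ (f i)) (toℕ (f (f i))) (toℕ (f (f (f i)))) (toℕ<n i) (toℕ<n (f (f (f i)))) (f-spec i) (f-spec (f i)) (f-spec (f (f i))))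

    -- A fixed point x satisfies x² - x + 1 = 0, so x - 1, which is `suc (toℕ i)`, is a root of x² +
    -- x + 1.
    cube-root : ¬ 3 ∣ m → ∃ λ x → p ∣ x * x + x + 1
    cube-root 3∤m = decide (any? (λ i → f i ≟ i))
      where
      lem : ∀ i → (1 + i) * (2 + i) + 1 ≡ (1 + i) * (1 + i) + (1 + i) + 1
      lem = solve-∀
      decide : Dec (∃ λ i → f i ≡ i) → ∃ λ x → p ∣ x * x + x + 1
      decide (yes (i , e)) = suc (toℕ i) , subst (p ∣_) (lem (toℕ i)) (subst (toℕ i ↝_) (cong toℕ e) (f-spec i))
      decide (no none)     = ⊥-elim (3∤m (order-three f f-cycle (λ i e → none (i , e))))

  ∣-norm⇒loeschian : ∀ n x → suc n ∣ x * x + x + 1 → Loeschian (suc n)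
  ∣-norm⇒loeschian n x (divides c e) = divisor-loeschian n (ℤ.+ x) (ℤ.+ c)
    (trans (sym (ℤₚ.pos-* (suc n) c)) (trans (cong ℤ.+_ (trans (*-comm (suc n) c) (sym e)))
      (cong (λ z → z ℤ.+ ℤ.+ x ℤ.+ ℤ.+ 1) (ℤₚ.pos-* x x))))

  prime-loeschian : ∀ p → Prime p → p % 3 ≡ 1 → Loeschian p
  prime-loeschian zero          _   ()
  prime-loeschian (suc zero)    pr  _ = ⊥-elim (¬prime[1] pr)
  prime-loeschian (suc (suc m)) pr e = let x , p∣ = cube-root m pr 3∤m in ∣-norm⇒loeschian (suc m) x p∣
    where
    3∤m : ¬ 3 ∣ m
    3∤m (divides q refl) with trans (sym e) ([m+kn]%n≡m%n 2 q 3)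
    ... | ()

-- Primes q ≡ 2 mod 3, including 2, occur in norms to even powers.

module InertPrimes where

  open NormForm using (N; Loeschian; divisor-loeschian)
  open SplitPrimes using (minus-inverse)
  open import Data.Empty using (⊥; ⊥-elim)
  open import Data.Nat.Base as ℕ using (ℕ; zero; suc; s≤s; z≤n; NonZero)
  import Data.Nat.Divisibility as ℕD
  open import Data.Nat.Induction using (<-rec)
  open import Data.Nat.Primality using (Prime; ¬prime[1]; euclidsLemma; prime⇒nonZero)
  import Data.Nat.Properties as ℕₚ
  import Data.Nat.Tactic.RingSolver as ℕ-Solver
  open import Data.Integer.Base hiding (suc; pred; NonZero)
  open import Data.Integer.Properties
  open import Data.Integer.DivMod using (_%ℕ_; _/ℕ_; n%ℕd<d; a≡a%ℕn+[a/ℕn]*n)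
  open import Data.Integer.Divisibility.Signed
  open import Data.Integer.Tactic.RingSolver using (solve-∀)
  open import Data.Product using (∃; _,_; proj₁; proj₂)
  open import Data.Sum using (_⊎_; inj₁; inj₂)
  open import Relation.Binary.PropositionalEquality
  open import Relation.Nullary using (Dec; ¬_; yes; no)

  3∤ : ∀ {n} z → + 3 * z ≡ + suc n → n ℕ.< 2 → ⊥
  3∤ {n} z e n<2 = ℕₚ.<⇒≱ (s≤s n<2) (ℕD.∣⇒≤ (∣⇒∣ᵤ {+ 3} {+ suc n} (divides z (trans (sym e) (*-comm (+ 3) z)))))

  square-mod-3 : ∀ i → ∃ λ z → i * i ≡ + 3 * z ⊎ i * i ≡ + 3 * z + + 1
  square-mod-3 i = go (i %ℕ 3) (n%ℕd<d i 3) (a≡a%ℕn+[a/ℕn]*n i 3)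
    where
    k : ℤ
    k = i /ℕ 3
    lem : ∀ r k → (r + k * + 3) * (r + k * + 3) ≡ + 3 * (+ 2 * r * k + + 3 * k * k) + r * r
    lem = solve-∀
    lem₂ : ∀ x → + 3 * x + + 4 ≡ + 3 * (x + + 1) + + 1
    lem₂ = solve-∀
    go : ∀ r → r ℕ.< 3 → i ≡ + r + k * + 3 → ∃ λ z → i * i ≡ + 3 * z ⊎ i * i ≡ + 3 * z + + 1
    go 0 _ e = + 2 * + 0 * k + + 3 * k * k , inj₁ (trans (cong (λ z → z * z) e) (trans (lem (+ 0) k) (+-identityʳ (+ 3 * (+ 2 * + 0 * k + + 3 * k * k)))))
    go 1 _ e = + 2 * + 1 * k + + 3 * k * k , inj₂ (trans (cong (λ z → z * z) e) (lem (+ 1) k))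
    go 2 _ e = + 2 * + 2 * k + + 3 * k * k + + 1 , inj₂ (trans (cong (λ z → z * z) e) (trans (lem (+ 2) k) (lem₂ (+ 2 * + 2 * k + + 3 * k * k))))
    go (suc (suc (suc _))) (s≤s (s≤s (s≤s ()))) _

  norm-mod-3 : ∀ a b → N a b ≡ (a - b) * (a - b) + + 3 * (a * b)
  norm-mod-3 = lem
    where
    lem : ∀ a b → a * a + a * b + b * b ≡ (a - b) * (a - b) + + 3 * (a * b)
    lem = solve-∀

  -- Modulo 3 the norm is the square (a - b)², and 2 is not a square.
  loeschian-mod-3 : ∀ n k → Loeschian n → + n ≢ + 3 * k + + 2
  loeschian-mod-3 n k (a , b , e) f = contra (square-mod-3 (a - b))
    where
    lem₁ : ∀ z k w → + 3 * (z + w - k) ≡ + 3 * z + + 3 * w - + 3 * k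
    lem₁ = solve-∀
    lem₂ : ∀ k → + 3 * k + + 2 - + 3 * k ≡ + 2
    lem₂ = solve-∀
    lem₃ : ∀ z k w → + 3 * (z + w - k) ≡ (+ 3 * z + + 1) + + 3 * w - + 3 * k - + 1
    lem₃ = solve-∀
    lem₄ : ∀ k → + 3 * k + + 2 - + 3 * k - + 1 ≡ + 1
    lem₄ = solve-∀
    total : ∀ {s} → (a - b) * (a - b) ≡ s → s + + 3 * (a * b) ≡ + 3 * k + + 2
    total refl = trans (sym (norm-mod-3 a b)) (trans (sym e) f)
    contra : (∃ λ z → (a - b) * (a - b) ≡ + 3 * z ⊎ (a - b) * (a - b) ≡ + 3 * z + + 1) → ⊥
    contra (z , inj₁ p) = 3∤ (z + a * b - k) (trans (lem₁ z k (a * b)) (trans (cong (λ x → x - + 3 * k) (total p)) (lem₂ k))) (s≤s (s≤s z≤n))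
    contra (z , inj₂ p) = 3∤ (z + a * b - k) (trans (lem₃ z k (a * b)) (trans (cong (λ x → x - + 3 * k - + 1) (total p)) (lem₄ k))) (s≤s z≤n)

  divides-ℕ : ∀ {m n} → + m ∣ + n → m ℕD.∣ n
  divides-ℕ = ∣⇒∣ᵤ

  module Inert (q k : ℕ) (q-prime : Prime q) (q≡ : q ≡ 3 ℕ.* k ℕ.+ 2) where

    not-loeschian : ¬ Loeschian q
    not-loeschian l = loeschian-mod-3 q (+ k) l (trans (cong +_ q≡) (cong (λ z → z + + 2) (pos-* 3 k)))

    -- Otherwise q, as a divisor of x² + x + 1, would be a norm by `divisor-loeschian`, yet it is 2
    -- modulo 3.
    no-root : ∀ x → ¬ + q ∣ x * x + x + + 1
    no-root x (divides c e) = go q refl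
      where
      go : ∀ r → q ≡ r → ⊥
      go zero    q≡0 = ℕₚ.m+1+n≢0 (3 ℕ.* k) (trans (sym q≡) q≡0)
      go (suc r) q≡r = not-loeschian (subst Loeschian (sym q≡r) (divisor-loeschian r x c
        (trans (*-comm (+ suc r) c) (trans (cong (λ z → c * + z) (sym q≡r)) (sym e)))))

    inverse : ∀ b → ¬ + q ∣ b → ∃ λ v → + q ∣ b * v + + 1
    inverse b q∤b = go q q-prime refl
      where
      go : ∀ r → Prime r → q ≡ r → ∃ λ v → + q ∣ b * v + + 1
      go zero          pr _ = ⊥-elim (ℕ.NonZero.nonZero (prime⇒nonZero pr))
      go (suc zero)    pr _ = ⊥-elim (¬prime[1] pr)
      go (suc (suc m)) pr q≡r = step (b %ℕ r) (n%ℕd<d b r) (a≡a%ℕn+[a/ℕn]*n b r)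
        where
        r : ℕ
        r = suc (suc m)
        j : ℤ
        j = b /ℕ r
        step : ∀ i → i ℕ.< r → b ≡ + i + j * + r → ∃ λ v → + q ∣ b * v + + 1
        step zero    _           b≡ = ⊥-elim (q∤b (divides j (trans b≡ (trans (+-identityˡ _) (cong (λ z → j * + z) (sym q≡r))))))
        step (suc i) (s≤s i<1+m) b≡ = + v , subst (λ z → + z ∣ b * + v + + 1) (sym q≡r)
          (subst (+ r ∣_) (trans (lem (+ suc i) (+ v) j (+ r)) (cong (λ z → z * + v + + 1) (sym b≡)))
            (∣m∣n⇒∣m+n (subst (+ r ∣_) (cong (λ z → z + + 1) (pos-* (suc i) v)) (∣ᵤ⇒∣ {+ r} {+ (suc i ℕ.* v ℕ.+ 1)} (proj₂ inv)))
                        (∣n⇒∣m*n (j * + v) ∣-refl)))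
          where
          inv : ∃ λ v → r ℕD.∣ suc i ℕ.* v ℕ.+ 1
          inv = minus-inverse m pr i i<1+m
          v : ℕ
          v = proj₁ inv
          lem : ∀ i v j r → i * v + + 1 + j * v * r ≡ (i + j * r) * v + + 1
          lem = solve-∀

    -- If b were invertible modulo q, scaling by v with bv ≡ -1 would turn the norm into x² + x + 1
    -- for x = -av.
    divides-right : ∀ a b → + q ∣ N a b → + q ∣ b
    divides-right a b q∣N = decide (+ q ∣? b)
      where
      lem : ∀ a b v → (a * a + a * b + b * b) * (v * v) - (b * v + + 1) * (a * v + b * v - + 1)
                    ≡ - (a * v) * - (a * v) + - (a * v) + + 1
      lem = solve-∀
      decide : Dec (+ q ∣ b) → + q ∣ b
      decide (yes q∣b) = q∣b
      decide (no q∤b)  = let v , q∣ = inverse b q∤b in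
        ⊥-elim (no-root (- (a * v)) (subst (+ q ∣_) (lem a b v)
          (∣m∣n⇒∣m-n (∣m⇒∣m*n (v * v) q∣N) (∣m⇒∣m*n (a * v + b * v - + 1) q∣))))

    divides-left : ∀ a b → + q ∣ N a b → + q ∣ a
    divides-left a b q∣N = divides-right b a (subst (+ q ∣_) (lem a b) q∣N)
      where
      lem : ∀ a b → a * a + a * b + b * b ≡ b * b + b * a + a * a
      lem = solve-∀

    -- The exponent of q in a norm is even.
    inert-exponent : ∀ s → .{{NonZero s}} → ∀ d a b → + (q ℕ.* (d ℕ.* (s ℕ.* s))) ≡ N a b → q ℕD.∣ d
    inert-exponent s = <-rec (λ s → .{{NonZero s}} → ∀ d a b → + (q ℕ.* (d ℕ.* (s ℕ.* s))) ≡ N a b → q ℕD.∣ d) step s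
      where
      instance
        q≢0 : NonZero q
        q≢0 = prime⇒nonZero q-prime
      step : ∀ s → (∀ {s′} → s′ ℕ.< s → .{{NonZero s′}} → ∀ d a b → + (q ℕ.* (d ℕ.* (s′ ℕ.* s′))) ≡ N a b → q ℕD.∣ d) →
             .{{NonZero s}} → ∀ d a b → + (q ℕ.* (d ℕ.* (s ℕ.* s))) ≡ N a b → q ℕD.∣ d
      step s rec d a b e = go (divides-left a b q∣N) (divides-right a b q∣N)
        where
        q∣N : + q ∣ N a b
        q∣N = subst (+ q ∣_) e (divides (+ (d ℕ.* (s ℕ.* s))) (trans (pos-* q (d ℕ.* (s ℕ.* s))) (*-comm (+ q) (+ (d ℕ.* (s ℕ.* s))))))
        go : + q ∣ a → + q ∣ b → q ℕD.∣ d
        go (divides a′ refl) (divides b′ refl) = split (euclidsLemma d (s ℕ.* s) q-prime q∣ds²)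
          where
          lem : ∀ q a b → (a * q) * (a * q) + (a * q) * (b * q) + (b * q) * (b * q) ≡ q * (q * (a * a + a * b + b * b))
          lem = solve-∀
          ds²≡ : + (d ℕ.* (s ℕ.* s)) ≡ + q * N a′ b′
          ds²≡ = *-cancelˡ-≡ (+ q) (+ (d ℕ.* (s ℕ.* s))) (+ q * N a′ b′) (trans (sym (pos-* q (d ℕ.* (s ℕ.* s)))) (trans e (lem (+ q) a′ b′)))
          q∣ds² : q ℕD.∣ d ℕ.* (s ℕ.* s)
          q∣ds² = divides-ℕ (divides (N a′ b′) (trans ds²≡ (*-comm (+ q) (N a′ b′))))
          -- With s = s′q and the factor q removed from a and b, the same equation holds for s′.
          descend : q ℕD.∣ s → q ℕD.∣ d
          descend (ℕD.divides s′ s≡) = rec s′<s {{s′≢0}} d a′ b′ (*-cancelˡ-≡ (+ q) (+ (q ℕ.* (d ℕ.* (s′ ℕ.* s′)))) (N a′ b′)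
            (trans (sym (pos-* q (q ℕ.* (d ℕ.* (s′ ℕ.* s′))))) (trans (cong +_ (trans (lem₂ q d s′) (cong (λ z → d ℕ.* (z ℕ.* z)) (sym s≡)))) ds²≡)))
            where
            lem₂ : ∀ q d s → q ℕ.* (q ℕ.* (d ℕ.* (s ℕ.* s))) ≡ d ℕ.* ((s ℕ.* q) ℕ.* (s ℕ.* q))
            lem₂ = ℕ-Solver.solve-∀
            s′≢0 : NonZero s′
            s′≢0 = ℕₚ.m*n≢0⇒m≢0 s′ {{subst NonZero s≡ (ℕ.≢-nonZero (ℕ.≢-nonZero⁻¹ s))}}
            s′<s : s′ ℕ.< s
            s′<s = subst (s′ ℕ.<_) (sym s≡) (ℕₚ.m<m*n s′ q {{s′≢0}} 1<q)
              where
              1<q : 1 ℕ.< q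
              1<q = subst (1 ℕ.<_) (trans (ℕₚ.+-comm 2 (3 ℕ.* k)) (sym q≡)) (s≤s (s≤s z≤n))
          split : q ℕD.∣ d ⊎ q ℕD.∣ s ℕ.* s → q ℕD.∣ d
          split (inj₁ q∣d)  = q∣d
          split (inj₂ q∣s²) with euclidsLemma s s q-prime q∣s²
          ... | inj₁ q∣s = descend q∣s
          ... | inj₂ q∣s = descend q∣s

-- Two and three squares.

module SmallRank where

  open Representation using (Rep; square-abs; pronic)
  open LargeRank using (necessary; 0≤⇒+)
  open NormForm using (N; Loeschian; loeschian-*; loeschian-square)
  open SplitPrimes using (prime-loeschian)
  open InertPrimes
  open import Data.Empty using (⊥; ⊥-elim)
  open import Data.List.Base using (List; []; _∷_)
  open import Data.List.Relation.Unary.All using (All; []; _∷_)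
  open import Data.Nat.Base as ℕ using (ℕ; zero; suc; s≤s; z≤n; NonZero; _%_)
  import Data.Nat.Divisibility as ℕD
  import Data.Nat.DivMod as ℕDM
  open import Data.Nat.Induction using (<-rec)
  open import Data.Nat.ListAction using (product)
  open import Data.Nat.Primality using (Prime; ¬prime[1]; euclidsLemma; prime⇒nonZero; prime⇒irreducible; prime?)
  open import Data.Nat.Primality.Factorisation using (factorise; module PrimeFactorisation)
  import Data.Nat.Properties as ℕₚ
  import Data.Nat.Tactic.RingSolver as ℕ-Solver
  open import Data.Integer.Base hiding (suc; pred; NonZero; _%_)
  open import Data.Integer.Properties
  import Data.Integer.Divisibility as ℤD
  open import Data.Integer.Divisibility.Signed
  open import Data.Integer.Tactic.RingSolver using (solve-∀)
  open import Data.Product using (Σ; ∃; _×_; _,_; proj₁; proj₂)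
  open import Data.Sum using (_⊎_; inj₁; inj₂; reduce)
  open import Data.Vec.Base using ([]; _∷_)
  open import Function.Bundles using (_⇔_; mk⇔)
  open import Relation.Binary.PropositionalEquality
  open import Relation.Nullary using (Dec; ¬_; yes; no)
  open import Relation.Nullary.Decidable using (_×-dec_; from-yes)

  module _ where
    open PrimeFactorisation

    loeschian-product : ∀ n → .{{NonZero n}} → (∀ q → Prime q → q ℕD.∣ n → Loeschian q) → Loeschian n
    loeschian-product n primes = subst Loeschian (sym (isFactorisation (factorise n)))
      (go (factors (factorise n)) (factorsPrime (factorise n))
          (λ q pr q∣ → primes q pr (subst (q ℕD.∣_) (sym (isFactorisation (factorise n))) q∣)))
      where
      go : ∀ as → All Prime as → (∀ q → Prime q → q ℕD.∣ product as → Loeschian q) → Loeschian (product as)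
      go []       _          _ = + 1 , + 0 , refl
      go (a ∷ as) (pa ∷ pas) h = loeschian-* a (product as) (h a pa (ℕD.m∣m*n (product as)))
        (go as pas (λ q pr q∣ → h q pr (ℕD.∣n⇒∣m*n a q∣)))

  part-i : ∀ n T → 𝒮 2 n T ⇔ (Σ ℤ λ y → + (2 ℕ.* n) - T * T ≡ y * y)
  part-i n T = mk⇔ to from
    where
    to : 𝒮 2 n T → Σ ℤ λ y → + (2 ℕ.* n) - T * T ≡ y * y
    to (x ∷ z ∷ [] , refl , e) = x - z ,
      trans (cong (λ w → w - (x + (z + + 0)) * (x + (z + + 0))) (trans (pos-* 2 n) (cong (λ w → + 2 * w) (sym e)))) (lem x z)
      where
      lem : ∀ x z → + 2 * (x * x + (z * z + + 0)) - (x + (z + + 0)) * (x + (z + + 0)) ≡ (x - z) * (x - z)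
      lem = solve-∀
    from : (Σ ℤ λ y → + (2 ℕ.* n) - T * T ≡ y * y) → 𝒮 2 n T
    from (y , e) = x ∷ x - y ∷ [] , trans (lem₁ x y) (trans (cong (λ z → z - y) 2x≡) (lem₂ T y)) ,
      *-cancelˡ-≡ (+ 2) (x * x + ((x - y) * (x - y) + + 0)) (+ n)
        (trans (lem₃ x y) (trans (cong (λ z → (z - y) * (z - y) + y * y) 2x≡) (trans (lem₄ T y)
          (trans (cong (λ z → T * T + z) (sym 2n-T²)) (lem₅ T (+ n))))))
      where
      h g x : ℤ
      h = proj₁ (pronic T)
      g = proj₁ (pronic y)
      -- Since T² + y² = 2n, twice this number is T + y; so x = (T + y) / 2 is obtained without a
      -- case distinction on parities.
      x = h + g - + n
      2n-T² : + 2 * + n - T * T ≡ y * y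
      2n-T² = trans (cong (λ z → z - T * T) (sym (pos-* 2 n))) e
      2x≡ : + 2 * x ≡ T + y
      2x≡ = trans (lem h g (+ n)) (trans (cong₂ (λ a b → a + b - + 2 * + n) (sym (proj₂ (pronic T))) (sym (proj₂ (pronic y))))
        (trans (cong (λ z → T * T + T + (z + y) - + 2 * + n) (sym 2n-T²)) (lem′ T y (+ n))))
        where
        lem : ∀ h g n → + 2 * (h + g - n) ≡ + 2 * h + + 2 * g - + 2 * n
        lem = solve-∀
        lem′ : ∀ t y n → t * t + t + (+ 2 * n - t * t + y) - + 2 * n ≡ t + y
        lem′ = solve-∀
      lem₁ : ∀ x y → x + (x - y + + 0) ≡ + 2 * x - y
      lem₁ = solve-∀
      lem₂ : ∀ t y → t + y - y ≡ t
      lem₂ = solve-∀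
      lem₃ : ∀ x y → + 2 * (x * x + ((x - y) * (x - y) + + 0)) ≡ (+ 2 * x - y) * (+ 2 * x - y) + y * y
      lem₃ = solve-∀
      lem₄ : ∀ t y → (t + y - y) * (t + y - y) + y * y ≡ t * t + y * y
      lem₄ = solve-∀
      lem₅ : ∀ t n → t * t + (+ 2 * n - t * t) ≡ + 2 * n
      lem₅ = solve-∀

  prime-2 : Prime 2
  prime-2 = from-yes (prime? 2)

  prime-3 : Prime 3
  prime-3 = from-yes (prime? 3)

  prime∣prime : ∀ {p q} → Prime p → Prime q → p ℕD.∣ q → q ≡ p
  prime∣prime p-prime q-prime p∣q with prime⇒irreducible q-prime p∣q
  ... | inj₁ refl = ⊥-elim (¬prime[1] p-prime)
  ... | inj₂ p≡q  = sym p≡q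

  norm-zero : ∀ a b → N a b ≡ + 0 → a ≡ + 0 × b ≡ + 0
  norm-zero a b e = second b a (trans (lem b a) e) , second a b e
    where
    lem : ∀ a b → a * a + a * b + b * b ≡ b * b + b * a + a * a
    lem = solve-∀
    lem′ : ∀ a b → + 4 * (a * a + a * b + b * b) ≡ (+ 2 * a + b) * (+ 2 * a + b) + + 3 * (b * b)
    lem′ = solve-∀
    second : ∀ a b → N a b ≡ + 0 → b ≡ + 0
    second a b e = ∣i∣≡0⇒i≡0 (reduce (ℕₚ.m*n≡0⇒m≡0∨n≡0 ∣ b ∣ (ℕₚ.m+n≡0⇒m≡0 (∣ b ∣ ℕ.* ∣ b ∣) (ℕₚ.m+n≡0⇒n≡0 (∣ + 2 * a + b ∣ ℕ.* ∣ + 2 * a + b ∣) (+-injective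
      (trans (cong₂ (λ x y → x + y) (sym (square-abs (+ 2 * a + b))) (trans (pos-* 3 (∣ b ∣ ℕ.* ∣ b ∣)) (cong (λ z → + 3 * z) (sym (square-abs b)))))
        (trans (sym (lem′ a b)) (cong (λ z → + 4 * z) e))))))))

  prime-mod-6 : ∀ q → Prime q → q ≢ 2 → q ≢ 3 → (∀ k → q ≢ 3 ℕ.* k ℕ.+ 2) → q % 6 ≡ 1
  prime-mod-6 q q-prime q≢2 q≢3 q≢3k+2 = go (q % 6) refl (ℕDM.m%n<n q 6)
    where
    k : ℕ
    k = q ℕ./ 6
    q≡ : ∀ {r} → q % 6 ≡ r → q ≡ r ℕ.+ k ℕ.* 6
    q≡ e = trans (ℕDM.m≡m%n+[m/n]*n q 6) (cong (ℕ._+ k ℕ.* 6) e)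
    lem₀ : ∀ k → 0 ℕ.+ k ℕ.* 6 ≡ (3 ℕ.* k) ℕ.* 2
    lem₀ = ℕ-Solver.solve-∀
    lem₂ : ∀ k → 2 ℕ.+ k ℕ.* 6 ≡ (3 ℕ.* k ℕ.+ 1) ℕ.* 2
    lem₂ = ℕ-Solver.solve-∀
    lem₃ : ∀ k → 3 ℕ.+ k ℕ.* 6 ≡ (2 ℕ.* k ℕ.+ 1) ℕ.* 3
    lem₃ = ℕ-Solver.solve-∀
    lem₄ : ∀ k → 4 ℕ.+ k ℕ.* 6 ≡ (3 ℕ.* k ℕ.+ 2) ℕ.* 2
    lem₄ = ℕ-Solver.solve-∀
    lem₅ : ∀ k → 5 ℕ.+ k ℕ.* 6 ≡ 3 ℕ.* (2 ℕ.* k ℕ.+ 1) ℕ.+ 2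
    lem₅ = ℕ-Solver.solve-∀
    go : ∀ r → q % 6 ≡ r → r ℕ.< 6 → q % 6 ≡ 1
    go 0 e _ = ⊥-elim (q≢2 (prime∣prime prime-2 q-prime (ℕD.divides (3 ℕ.* k) (trans (q≡ e) (lem₀ k)))))
    go 1 e _ = e
    go 2 e _ = ⊥-elim (q≢2 (prime∣prime prime-2 q-prime (ℕD.divides (3 ℕ.* k ℕ.+ 1) (trans (q≡ e) (lem₂ k)))))
    go 3 e _ = ⊥-elim (q≢3 (prime∣prime prime-3 q-prime (ℕD.divides (2 ℕ.* k ℕ.+ 1) (trans (q≡ e) (lem₃ k)))))
    go 4 e _ = ⊥-elim (q≢2 (prime∣prime prime-2 q-prime (ℕD.divides (3 ℕ.* k ℕ.+ 2) (trans (q≡ e) (lem₄ k)))))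
    go 5 e _ = ⊥-elim (q≢3k+2 (2 ℕ.* k ℕ.+ 1) (trans (q≡ e) (lem₅ k)))
    go (suc (suc (suc (suc (suc (suc _)))))) _ (s≤s (s≤s (s≤s (s≤s (s≤s (s≤s ()))))))

  Decomposed : ℕ → Set
  Decomposed E = ∃ λ D₀ → ∃ λ D₁ → SquareFree D₀ × E ≡ D₀ ℕ.* (D₁ ℕ.* D₁)

  -- Square divisors d² with d ≥ 2 are stripped until none is left. The search may stop at E, as d ≤
  -- d² ≤ E.
  decompose : ∀ E → .{{NonZero E}} → Decomposed E
  decompose E = <-rec (λ E → .{{NonZero E}} → Decomposed E) step E
    where
    step : ∀ E → (∀ {E′} → E′ ℕ.< E → .{{NonZero E′}} → Decomposed E′) → .{{NonZero E}} → Decomposed E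
    step E rec = decide (ℕₚ.anyUpTo? (λ d → (2 ℕₚ.≤? d) ×-dec ((d ℕ.* d) ℕD.∣? E)) (suc E))
      where
      decide : Dec (∃ λ d → d ℕ.< suc E × (2 ℕ.≤ d × (d ℕ.* d) ℕD.∣ E)) → Decomposed E
      decide (no none) = E , 1 , (λ p p-prime p²∣E → none (p ,
        s≤s (ℕD.∣⇒≤ (ℕD.∣-trans (ℕD.m∣m*n p) p²∣E)) , two p p-prime , p²∣E)) , sym (ℕₚ.*-identityʳ E)
        where
        two : ∀ p → Prime p → 2 ℕ.≤ p
        two zero          pr = ⊥-elim (ℕ.NonZero.nonZero (prime⇒nonZero pr))
        two (suc zero)    pr = ⊥-elim (¬prime[1] pr)
        two (suc (suc _)) _  = s≤s (s≤s z≤n)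
      decide (yes (d , _ , 2≤d , ℕD.divides E′ E≡)) = extend (rec E′<E {{E′≢0}})
        where
        E′≢0 : NonZero E′
        E′≢0 = ℕₚ.m*n≢0⇒m≢0 E′ {{subst NonZero E≡ (ℕ.≢-nonZero (ℕ.≢-nonZero⁻¹ E))}}
        E′<E : E′ ℕ.< E
        E′<E = subst (E′ ℕ.<_) (sym E≡) (ℕₚ.m<m*n E′ (d ℕ.* d) {{E′≢0}}
          (ℕₚ.≤-trans 2≤d (ℕₚ.m≤m*n d d {{ℕ.>-nonZero (ℕₚ.≤-trans (s≤s z≤n) 2≤d)}})))
        lem : ∀ a b d → a ℕ.* (b ℕ.* b) ℕ.* (d ℕ.* d) ≡ a ℕ.* ((b ℕ.* d) ℕ.* (b ℕ.* d))
        lem = ℕ-Solver.solve-∀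
        extend : Decomposed E′ → Decomposed E
        extend (D₀ , D₁ , sf , e) = D₀ , D₁ ℕ.* d , sf , trans E≡ (trans (cong (ℕ._* (d ℕ.* d)) e) (lem D₀ D₁ d))

  -- The numbers x, y, z are determined by their sum and the differences a = x - y and b = y - z.
  recover : ∀ ν T a b → + 3 * ν - T * T ≡ + 2 * N a b → + 3 ∣ T - a + b → Rep 3 ν T
  recover ν T a b e (divides y 3y≡) = y + a ∷ y ∷ y - b ∷ [] , trans (lem₁ y a b) (sym T≡) ,
    *-cancelˡ-≡ (+ 3) ((y + a) * (y + a) + (y * y + ((y - b) * (y - b) + + 0))) ν
      (trans (lem₂ y a b) (trans (cong₂ (λ t n → t * t + n) (sym T≡) (sym e)) (lem₃ ν T)))
    where
    lem₀ : ∀ T a b → T ≡ T - a + b + a - b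
    lem₀ = solve-∀
    T≡ : T ≡ y * + 3 + a - b
    T≡ = trans (lem₀ T a b) (cong (λ z → z + a - b) 3y≡)
    lem₁ : ∀ y a b → y + a + (y + (y - b + + 0)) ≡ y * + 3 + a - b
    lem₁ = solve-∀
    lem₂ : ∀ y a b → + 3 * ((y + a) * (y + a) + (y * y + ((y - b) * (y - b) + + 0)))
                   ≡ (y * + 3 + a - b) * (y * + 3 + a - b) + + 2 * (a * a + a * b + b * b)
    lem₂ = solve-∀
    lem₃ : ∀ ν T → T * T + (+ 3 * ν - T * T) ≡ + 3 * ν
    lem₃ = solve-∀

  -- As 2N + (a - b)² = 3(a² + b²), the prime 3 divides T² - (a - b)² and hence T - (a - b) or T +
  -- (a - b). In the second case (a, b) is replaced by (-a, -b), which has the same norm.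
  three : ∀ ν T a b → + 3 * ν - T * T ≡ + 2 * N a b → Rep 3 ν T
  three ν T a b e = either (euclidsLemma ∣ T - a + b ∣ ∣ T - - a + - b ∣ prime-3
      (subst (3 ℕD.∣_) (abs-* (T - a + b) (T - - a + - b)) (∣⇒∣ᵤ {+ 3} (divides (ν - a * a - b * b) product≡))))
    where
    lem : ∀ ν T a b → (T - a + b) * (T - - a + - b) ≡ + 3 * ν - (+ 3 * ν - T * T) - (a - b) * (a - b)
    lem = solve-∀
    lem′ : ∀ ν a b → + 3 * ν - + 2 * (a * a + a * b + b * b) - (a - b) * (a - b) ≡ (ν - a * a - b * b) * + 3
    lem′ = solve-∀
    lem″ : ∀ a b → a * a + a * b + b * b ≡ - a * - a + - a * - b + - b * - b
    lem″ = solve-∀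
    product≡ : (T - a + b) * (T - - a + - b) ≡ (ν - a * a - b * b) * + 3
    product≡ = trans (lem ν T a b) (trans (cong (λ z → + 3 * ν - z - (a - b) * (a - b)) e) (lem′ ν a b))
    either : 3 ℕD.∣ ∣ T - a + b ∣ ⊎ 3 ℕD.∣ ∣ T - - a + - b ∣ → Rep 3 ν T
    either (inj₁ 3∣) = recover ν T a b e (∣ᵤ⇒∣ {+ 3} 3∣)
    either (inj₂ 3∣) = recover ν T (- a) (- b) (trans e (cong (λ z → + 2 * z) (lem″ a b))) (∣ᵤ⇒∣ {+ 3} 3∣)

  differences : ∀ ν T x y z → x + (y + (z + + 0)) ≡ T → x * x + (y * y + (z * z + + 0)) ≡ ν →
    + 3 * ν - T * T ≡ + 2 * N (x - y) (y - z)
  differences _ _ x y z refl refl = lem x y z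
    where
    lem : ∀ x y z → + 3 * (x * x + (y * y + (z * z + + 0))) - (x + (y + (z + + 0))) * (x + (y + (z + + 0)))
      ≡ + 2 * ((x - y) * (x - y) + (x - y) * (y - z) + (y - z) * (y - z))
    lem = solve-∀

  -- Conditions (a) and (b) read off D₀: `3 ∣ D₀` is ℓ = 1, `2 ∣ D₀` is k = 1, and gcd(3, T, n) = 3
  -- says that 3 divides T and n.
  NormConditions : ℕ → ℤ → ℕ → Set
  NormConditions n T D₀ =
    ((q : ℕ) → Prime q → q ℕD.∣ D₀ → q ≢ 2 → q ≢ 3 → q % 6 ≡ 1)
    × ((3 ℕD.∣ D₀ ⊎ ((+ 3) ℤD.∣ T × 3 ℕD.∣ n)) → 2 ℕD.∣ D₀)

  module TwiceNorm (D₀ D₁ : ℕ) (D₁≢0 : NonZero D₁) (squarefree : SquareFree D₀) (a b : ℤ)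
    (e : + (D₀ ℕ.* (D₁ ℕ.* D₁)) ≡ + 2 * N a b) where

    -- The prime 2 is inert, so it has odd exponent in twice a norm, while D₁² contributes an even
    -- one.
    even-part : 2 ℕD.∣ D₀
    even-part with euclidsLemma D₀ (D₁ ℕ.* D₁) prime-2 (∣⇒∣ᵤ {+ 2} {+ (D₀ ℕ.* (D₁ ℕ.* D₁))} (divides (N a b) (trans e (*-comm (+ 2) (N a b)))))
    ... | inj₁ 2∣D₀ = 2∣D₀
    ... | inj₂ 2∣D₁² = halve (reduce (euclidsLemma D₁ D₁ prime-2 2∣D₁²))
      where
      lem : ∀ d s → 2 ℕ.* (2 ℕ.* (d ℕ.* (s ℕ.* s))) ≡ d ℕ.* ((s ℕ.* 2) ℕ.* (s ℕ.* 2))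
      lem = ℕ-Solver.solve-∀
      halve : 2 ℕD.∣ D₁ → 2 ℕD.∣ D₀
      halve (ℕD.divides s D₁≡) = Inert.inert-exponent 2 0 prime-2 refl s
        {{ℕₚ.m*n≢0⇒m≢0 s {{subst NonZero D₁≡ D₁≢0}}}} D₀ a b
        (*-cancelˡ-≡ (+ 2) (+ (2 ℕ.* (D₀ ℕ.* (s ℕ.* s)))) (N a b) (trans (sym (pos-* 2 (2 ℕ.* (D₀ ℕ.* (s ℕ.* s)))))
          (trans (cong +_ (trans (lem D₀ s) (cong (λ d → D₀ ℕ.* (d ℕ.* d)) (sym D₁≡)))) e)))

    -- Doubling makes D₀D₁² a norm, 2 · 2N(a, b) = N(2a, 2b). An inert q ≠ 2 in D₀ would then have
    -- even exponent in D₀, against squarefreeness.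
    odd-part : ∀ q → Prime q → q ℕD.∣ D₀ → q ≢ 2 → q ≢ 3 → q % 6 ≡ 1
    odd-part q q-prime (ℕD.divides d D₀≡) q≢2 q≢3 = prime-mod-6 q q-prime q≢2 q≢3 λ k q≡ →
      contra (euclidsLemma 2 d q-prime (Inert.inert-exponent q k q-prime q≡ D₁ {{D₁≢0}} (2 ℕ.* d) (+ 2 * a) (+ 2 * b)
        (trans (cong +_ (trans (lem q d D₁) (cong (λ z → 2 ℕ.* (z ℕ.* (D₁ ℕ.* D₁))) (sym D₀≡))))
          (trans (pos-* 2 (D₀ ℕ.* (D₁ ℕ.* D₁))) (trans (cong (λ z → + 2 * z) e) (lem′ a b))))))
      where
      lem : ∀ q d s → q ℕ.* (2 ℕ.* d ℕ.* (s ℕ.* s)) ≡ 2 ℕ.* (d ℕ.* q ℕ.* (s ℕ.* s))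
      lem = ℕ-Solver.solve-∀
      lem′ : ∀ a b → + 2 * (+ 2 * (a * a + a * b + b * b)) ≡ (+ 2 * a) * (+ 2 * a) + (+ 2 * a) * (+ 2 * b) + (+ 2 * b) * (+ 2 * b)
      lem′ = solve-∀
      contra : q ℕD.∣ 2 ⊎ q ℕD.∣ d → ⊥
      contra (inj₁ q∣2) = q≢2 (sym (prime∣prime q-prime prime-2 q∣2))
      contra (inj₂ q∣d) = squarefree q q-prime (subst (q ℕ.* q ℕD.∣_) (sym D₀≡) (ℕD.*-monoˡ-∣ q q∣d))

  module _ (n : ℕ) (T : ℤ) (D₀ D₁ : ℕ) (squarefree : SquareFree D₀)
    (e : + 3 * + n - T * T ≡ + (D₀ ℕ.* (D₁ ℕ.* D₁))) (D₀≢0 : NonZero D₀) (conditions : NormConditions n T D₀) where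

    prime-factor : ∀ q → Prime q → q ℕD.∣ D₀ → q ≢ 2 → Loeschian q
    prime-factor q q-prime q∣D₀ q≢2 with q ℕₚ.≟ 3
    ... | yes refl = + 1 , + 1 , refl
    ... | no q≢3   = prime-loeschian q q-prime (mod-3 (proj₁ conditions q q-prime q∣D₀ q≢2 q≢3))
      where
      mod-3 : q % 6 ≡ 1 → q % 3 ≡ 1
      mod-3 e = trans (cong (_% 3) (trans (ℕDM.m≡m%n+[m/n]*n q 6) (trans (cong (ℕ._+ q ℕ./ 6 ℕ.* 6) e) (lem (q ℕ./ 6)))))
        (ℕDM.[m+kn]%n≡m%n 1 (2 ℕ.* (q ℕ./ 6)) 3)
        where
        lem : ∀ k → 1 ℕ.+ k ℕ.* 6 ≡ 1 ℕ.+ 2 ℕ.* k ℕ.* 3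
        lem = ℕ-Solver.solve-∀

    -- If 3 divides T, it divides D₀D₁². When it divides D₁, then 9 divides 3n, so 3 divides n.
    -- Either way (b) applies.
    3∣T⇒even : + 3 ∣ T → 2 ℕD.∣ D₀
    3∣T⇒even 3∣T@(divides t T≡) = either (euclidsLemma D₀ (D₁ ℕ.* D₁) prime-3
        (∣⇒∣ᵤ {+ 3} {+ (D₀ ℕ.* (D₁ ℕ.* D₁))} (divides (+ n - + 3 * (t * t)) (trans (sym e) (trans (cong (λ z → + 3 * + n - z * z) T≡) (lem (+ n) t))))))
      where
      lem : ∀ n t → + 3 * n - (t * + 3) * (t * + 3) ≡ (n - + 3 * (t * t)) * + 3
      lem = solve-∀
      lem′ : ∀ n t d s → n ≡ (n - + 3 * (t * t) - + 3 * (d * (s * s))) + (t * t + d * (s * s)) * + 3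
      lem′ = solve-∀
      3∣n : 3 ℕD.∣ D₁ → 3 ℕD.∣ n
      3∣n (ℕD.divides s D₁≡) = ∣⇒∣ᵤ {+ 3} {+ n} (divides (t * t + + D₀ * (+ s * + s))
        (trans (lem′ (+ n) t (+ D₀) (+ s)) (trans (cong (λ z → z + (t * t + + D₀ * (+ s * + s)) * + 3) zero≡) (+-identityˡ _))))
        where
        lem₁ : ∀ n t d s → + 3 * (n - + 3 * (t * t) - + 3 * (d * (s * s))) ≡ + 3 * n - (t * + 3) * (t * + 3) - d * ((s * + 3) * (s * + 3))
        lem₁ = solve-∀
        pos-D : + (D₀ ℕ.* (D₁ ℕ.* D₁)) ≡ + D₀ * ((+ s * + 3) * (+ s * + 3))
        pos-D = trans (pos-* D₀ (D₁ ℕ.* D₁)) (cong (λ z → + D₀ * z) (trans (pos-* D₁ D₁)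
          (cong (λ z → z * z) (trans (cong +_ D₁≡) (pos-* s 3)))))
        zero≡ : + n - + 3 * (t * t) - + 3 * (+ D₀ * (+ s * + s)) ≡ + 0
        zero≡ = *-cancelˡ-≡ (+ 3) (+ n - + 3 * (t * t) - + 3 * (+ D₀ * (+ s * + s))) (+ 0)
          (trans (lem₁ (+ n) t (+ D₀) (+ s)) (i≡j⇒i-j≡0 (trans (cong (λ z → + 3 * + n - z * z) (sym T≡)) (trans e pos-D))))
      either : 3 ℕD.∣ D₀ ⊎ 3 ℕD.∣ D₁ ℕ.* D₁ → 2 ℕD.∣ D₀
      either (inj₁ 3∣D₀)  = proj₂ conditions (inj₁ 3∣D₀)
      either (inj₂ 3∣D₁²) = proj₂ conditions (inj₂ (∣⇒∣ᵤ 3∣T , 3∣n (reduce (euclidsLemma D₁ D₁ prime-3 3∣D₁²))))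

    -- Suppose 3 does not divide T, so that 3n - T² ≡ 2 mod 3. If D₀ were odd, all its primes would
    -- be norms by (a), and so would D₀D₁², which is impossible in this residue class.
    D₀-even : 2 ℕD.∣ D₀
    D₀-even with + 3 ∣? T | 2 ℕD.∣? D₀
    ... | _       | yes 2∣D₀ = 2∣D₀
    ... | yes 3∣T | no _     = 3∣T⇒even 3∣T
    ... | no 3∤T  | no 2∤D₀  = ⊥-elim (contra (square-mod-3 T))
      where
      norm : Loeschian (D₀ ℕ.* (D₁ ℕ.* D₁))
      norm = loeschian-* D₀ (D₁ ℕ.* D₁) (loeschian-product D₀ {{D₀≢0}} (λ q q-prime q∣D₀ → prime-factor q q-prime q∣D₀
        (λ q≡2 → 2∤D₀ (subst (ℕD._∣ D₀) q≡2 q∣D₀)))) (loeschian-square D₁)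
      lem : ∀ n z → + 3 * n - (+ 3 * z + + 1) ≡ + 3 * (n - z - + 1) + + 2
      lem = solve-∀
      contra : (∃ λ z → T * T ≡ + 3 * z ⊎ T * T ≡ + 3 * z + + 1) → ⊥
      contra (z , inj₁ p) = 3∤T (∣ᵤ⇒∣ {+ 3} {T} (reduce (euclidsLemma ∣ T ∣ ∣ T ∣ prime-3
        (subst (3 ℕD.∣_) (abs-* T T) (∣⇒∣ᵤ {+ 3} {T * T} (divides z (trans p (*-comm (+ 3) z))))))))
      contra (z , inj₂ p) = loeschian-mod-3 (D₀ ℕ.* (D₁ ℕ.* D₁)) (+ n - z - + 1) norm
        (trans (sym e) (trans (cong (λ s → + 3 * + n - s) p) (lem (+ n) z)))

    -- Squarefreeness makes D₀ / 2 odd, so its primes are 3 or 1 modulo 3, and all of them are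
    -- norms.
    twice-norm : ∃ λ a → ∃ λ b → + 3 * + n - T * T ≡ + 2 * N a b
    twice-norm = half D₀-even
      where
      half : 2 ℕD.∣ D₀ → ∃ λ a → ∃ λ b → + 3 * + n - T * T ≡ + 2 * N a b
      half (ℕD.divides d D₀≡) = let a , b , p = norm in a , b ,
        trans e (trans (cong +_ (trans (cong (ℕ._* (D₁ ℕ.* D₁)) D₀≡) (lem d (D₁ ℕ.* D₁))))
          (trans (pos-* 2 (d ℕ.* (D₁ ℕ.* D₁))) (cong (λ z → + 2 * z) p)))
        where
        lem : ∀ d s → d ℕ.* 2 ℕ.* s ≡ 2 ℕ.* (d ℕ.* s)
        lem = ℕ-Solver.solve-∀
        d≢0 : NonZero d
        d≢0 = ℕₚ.m*n≢0⇒m≢0 d {{subst NonZero D₀≡ D₀≢0}}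
        odd-factor : ∀ q → q ℕD.∣ d → q ≢ 2
        odd-factor _ 2∣d refl = squarefree 2 prime-2 (subst (4 ℕD.∣_) (sym D₀≡) (ℕD.*-monoˡ-∣ 2 2∣d))
        norm : Loeschian (d ℕ.* (D₁ ℕ.* D₁))
        norm = loeschian-* d (D₁ ℕ.* D₁) (loeschian-product d {{d≢0}} (λ q q-prime q∣d →
          prime-factor q q-prime (subst (q ℕD.∣_) (sym D₀≡) (ℕD.∣m⇒∣m*n 2 q∣d)) (odd-factor q q∣d))) (loeschian-square D₁)

  Degenerate : ℕ → ℤ → Set
  Degenerate n T = Σ ℕ λ t → NonZero t × (T ≡ + (3 ℕ.* t) ⊎ T ≡ - + (3 ℕ.* t)) × n ≡ 3 ℕ.* (t ℕ.* t)

  degenerate : ∀ n T → Degenerate n T → 𝒮 3 n T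
  degenerate n T (t , _ , T≡ , n≡) = triple T≡
    where
    lem₁ : ∀ x → x + (x + (x + + 0)) ≡ + 3 * x
    lem₁ = solve-∀
    lem₂ : ∀ x → x * x + (x * x + (x * x + + 0)) ≡ + 3 * (x * x)
    lem₂ = solve-∀
    3t²≡n : + 3 * (+ t * + t) ≡ + n
    3t²≡n = sym (trans (cong +_ n≡) (trans (pos-* 3 (t ℕ.* t)) (cong (λ z → + 3 * z) (pos-* t t))))
    lem₃ : ∀ t → - t * - t ≡ t * t
    lem₃ = solve-∀
    lem₄ : ∀ t → + 3 * - t ≡ - (+ 3 * t)
    lem₄ = solve-∀
    triple : T ≡ + (3 ℕ.* t) ⊎ T ≡ - + (3 ℕ.* t) → 𝒮 3 n T
    triple (inj₁ T≡) = + t ∷ + t ∷ + t ∷ [] , trans (lem₁ (+ t)) (trans (sym (pos-* 3 t)) (sym T≡)) , trans (lem₂ (+ t)) 3t²≡n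
    triple (inj₂ T≡) = - + t ∷ - + t ∷ - + t ∷ [] ,
      trans (lem₁ (- + t)) (trans (lem₄ (+ t)) (trans (cong -_ (sym (pos-* 3 t))) (sym T≡))) ,
      trans (lem₂ (- + t)) (trans (cong (λ z → + 3 * z) (lem₃ (+ t))) 3t²≡n)

  all-equal : ∀ n → .{{NonZero n}} → ∀ T x → x + (x + (x + + 0)) ≡ T → x * x + (x * x + (x * x + + 0)) ≡ + n → Degenerate n T
  all-equal n T x e f = ∣ x ∣ , ∣x∣≢0 , sign-case x (trans (lem₁ x) e) , n≡
    where
    lem₁ : ∀ x → + 3 * x ≡ x + (x + (x + + 0))
    lem₁ = solve-∀
    lem₂ : ∀ x → + 3 * (x * x) ≡ x * x + (x * x + (x * x + + 0))
    lem₂ = solve-∀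
    n≡ : n ≡ 3 ℕ.* (∣ x ∣ ℕ.* ∣ x ∣)
    n≡ = +-injective (trans (sym f) (trans (sym (lem₂ x)) (trans (cong (λ z → + 3 * z) (square-abs x)) (sym (pos-* 3 (∣ x ∣ ℕ.* ∣ x ∣))))))
    ∣x∣≢0 : NonZero ∣ x ∣
    ∣x∣≢0 = ℕ.≢-nonZero λ p → ℕ.≢-nonZero⁻¹ n (trans n≡ (cong (λ z → 3 ℕ.* (z ℕ.* z)) p))
    sign-case : ∀ x → + 3 * x ≡ T → T ≡ + (3 ℕ.* ∣ x ∣) ⊎ T ≡ - + (3 ℕ.* ∣ x ∣)
    sign-case (+ k)    p = inj₁ (trans (sym p) (sym (pos-* 3 k)))
    sign-case -[1+ k ] p = inj₂ (sym p)

  part-ii : ∀ n → .{{NonZero n}} → ∀ T →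
    𝒮 3 n T ⇔ (Degenerate n T ⊎ ((+ 0 < + (3 ℕ.* n) - T * T)
      × ((D₀ D₁ : ℕ) → SquareFree D₀ → + (3 ℕ.* n) - T * T ≡ + (D₀ ℕ.* (D₁ ℕ.* D₁)) → NormConditions n T D₀)))
  part-ii n T = mk⇔ to from
    where
    to : 𝒮 3 n T → _
    to v@(x ∷ y ∷ z ∷ [] , e , f) = by-discriminant (0≤⇒+ (proj₂ (necessary 3 n T v)))
      where
      a b : ℤ
      a = x - y
      b = y - z
      Δ≡ : + (3 ℕ.* n) - T * T ≡ + 2 * N a b
      Δ≡ = trans (cong (λ m → m - T * T) (pos-* 3 n)) (differences (+ n) T x y z e f)
      by-discriminant : (∃ λ d → + (3 ℕ.* n) - T * T ≡ + d) → _
      by-discriminant (zero , Δ≡0) = inj₁ (all-equal n T z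
          (subst₂ (λ x y → x + (y + (z + + 0)) ≡ T) x≡z y≡z e)
          (subst₂ (λ x y → x * x + (y * y + (z * z + + 0)) ≡ + n) x≡z y≡z f))
        where
        a≡0×b≡0 : a ≡ + 0 × b ≡ + 0
        a≡0×b≡0 = norm-zero a b (*-cancelˡ-≡ (+ 2) (N a b) (+ 0) (trans (sym Δ≡) Δ≡0))
        y≡z : y ≡ z
        y≡z = i-j≡0⇒i≡j y z (proj₂ a≡0×b≡0)
        x≡z : x ≡ z
        x≡z = trans (i-j≡0⇒i≡j x y (proj₁ a≡0×b≡0)) y≡z
      -- That D₁ is nonzero, which the descent on D₁ needs, comes from 3n - T² > 0.
      by-discriminant (suc d , Δ≡d) = inj₂ (subst (+ 0 <_) (sym Δ≡d) (+<+ (s≤s z≤n)) , λ D₀ D₁ squarefree Δ≡D →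
        let D₁≢0 = ℕ.≢-nonZero λ D₁≡0 → ℕₚ.1+n≢0 (+-injective (trans (sym Δ≡d) (trans Δ≡D
                     (cong +_ (trans (cong (λ s → D₀ ℕ.* (s ℕ.* s)) D₁≡0) (ℕₚ.*-zeroʳ D₀))))))
            open TwiceNorm D₀ D₁ D₁≢0 squarefree a b (trans (sym Δ≡D) Δ≡)
        in odd-part , λ _ → even-part)
    from : Degenerate n T ⊎ _ → 𝒮 3 n T
    from (inj₁ d) = degenerate n T d
    from (inj₂ (0<Δ , conditions)) = by-discriminant (0≤⇒+ (<⇒≤ 0<Δ))
      where
      by-discriminant : (∃ λ d → + (3 ℕ.* n) - T * T ≡ + d) → 𝒮 3 n T
      by-discriminant (zero  , Δ≡0) = ⊥-elim (<-irrefl (sym Δ≡0) 0<Δ)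
      -- The conditions are given for every decomposition D₀D₁² with squarefree D₀, so one has to be
      -- exhibited to use them.
      by-discriminant (suc d , Δ≡d) =
        let D₀ , D₁ , squarefree , E≡ = decompose (suc d)
            Δ≡D = trans Δ≡d (cong +_ E≡)
            a , b , p = twice-norm n T D₀ D₁ squarefree (trans (cong (λ m → m - T * T) (sym (pos-* 3 n))) Δ≡D)
              (ℕₚ.m*n≢0⇒m≢0 D₀ {{subst NonZero E≡ _}}) (conditions D₀ D₁ squarefree Δ≡D)
        in three (+ n) T a b p

open import Data.Nat as ℕ using (ℕ; NonZero; _%_)
open import Data.Nat.Divisibility as ℕD using ()
open import Data.Nat.Primality using (Prime)
open import Data.Integer as ℤ using (ℤ; +_; -_; _-_; _*_; _<_; _≤_)
open import Data.Integer.Divisibility as ℤD using ()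
open import Data.Product using (Σ; ∃; _×_)
open import Data.Sum using (_⊎_)
open import Relation.Binary.PropositionalEquality using (_≡_; _≢_)
open import Function.Bundles using (_⇔_)
open import Data.Product using (_,_)
open LargeRank using (part-iv)
open SmallRank using (part-i; part-ii)

theorem3p4 : (n : ℕ) → .{{_ : NonZero n}} → (T : ℤ) →
    (𝒮 2 n T ⇔ (Σ ℤ λ y → + (2 ℕ.* n) - T * T ≡ y * y))
    × (𝒮 3 n T ⇔
    ((Σ ℕ λ t → NonZero t × (T ≡ + (3 ℕ.* t) ⊎ T ≡ - + (3 ℕ.* t)) × n ≡ 3 ℕ.* (t ℕ.* t))
    ⊎ ((+ 0 < + (3 ℕ.* n) - T * T)
    × ((D₀ D₁ : ℕ) → SquareFree D₀ → + (3 ℕ.* n) - T * T ≡ + (D₀ ℕ.* (D₁ ℕ.* D₁)) →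
    ((q : ℕ) → Prime q → q ℕD.∣ D₀ → q ≢ 2 → q ≢ 3 → q % 6 ≡ 1)
    × ((3 ℕD.∣ D₀ ⊎ ((+ 3) ℤD.∣ T × 3 ℕD.∣ n)) → 2 ℕD.∣ D₀)))))
    × ((m : ℕ) → 5 ℕ.≤ m → m ℕ.≤ 7 →
    (𝒮 m n T ⇔ (SameParity n T × + 0 ≤ + (m ℕ.* n) - T * T)) × Full m n)
theorem3p4 n T = part-i n T , part-ii n T , part-iv n T
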